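{- There is a function $g(d)=O(\log^4(d+1)\,\log\log(d+1))$ such that for every integer $n$ and all $d=d(n)$, $d'=d'(n)$ with $d\le 2^{n/4}$ and $g(d)<d'<d/8-1$: (i) $\mathsf{NOBDD^{\lfloor\log d\rfloor}}\subsetneq\mathsf{OBDD^{d}}$; and (ii) $\mathsf{OBDD^{d}}$ and $\mathsf{NOBDD^{d'}}$ are incomparable, i.e. neither is contained in the other.
   Context: $\log$ is base $2$. $\mathsf{OBDD^d}$ (resp. $\mathsf{NOBDD^d}$) denotes the set of Boolean functions $f:\{0,1\}^n\to\{0,1\}$ computable by a deterministic (resp. nondeterministic) OBDD of width $d$ (at most $d$ nodes per level), $n$ being the number of variables. A deterministic OBDD on $x_1,\dots,x_n$ with order $\pi$ (a permutation of $\{1,\dots,n\}$) is a leveled directed acyclic graph with levels $0,\dots,n$, a single source at level $0$, every node at level $j-1$ having exactly one outgoing edge labelled $0$ and one labelled $1$ to nodes at level $j$, and nodes at level $n$ marked accepting or rejecting; on input $\nu$ one follows from the source at step $j$ the edge labelled $\nu_{\pi(j)}$ and outputs $1$ iff an accepting node is reached. A nondeterministic OBDD allows any number of outgoing edges with each label and outputs $1$ iff some consistent path reaches an accepting node. Width is the maximum number of nodes in a level. -}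

module Defs where

open import Data.Nat using (ℕ; zero; suc; _≤_; _<_)
open import Data.Nat.Properties using (<⇒≤)
open import Data.Fin using (Fin; fromℕ<)
open import Data.Fin.Permutation using (Permutation′; _⟨$⟩ʳ_)
open import Data.Bool using (Bool; true)
open import Data.Product using (Σ; _×_; ∃)
open import Data.Unit using (⊤)
open import Relation.Binary.PropositionalEquality using (_≡_)
open import Relation.Nullary using (¬_)
open import Function.Bundles using (_⇔_)

BoolFun : ℕ → Set
BoolFun n = (Fin n → Bool) → Bool

-- Level sizes: level 0 consists of the single source; level (suc j) has
-- w j nodes (w is the width profile of levels 1 … n).
LevelSize : (ℕ → ℕ) → ℕ → ℕ
LevelSize w zero    = 1
LevelSize w (suc j) = w j

-- Deterministic OBDD on x_1..x_n: variable order π, levels 0..n, from each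
-- node at level j exactly one 0-edge and one 1-edge to level j+1 (the
-- transition δ j), and an accept/reject marking of the nodes of level n.
-- The step from level j to j+1 (j < n) reads variable π(j).
record OBDD (n : ℕ) : Set where
  field
    order : Permutation′ n
    width : ℕ → ℕ
    δ     : (j : ℕ) → j < n → Fin (LevelSize width j) → Bool → Fin (width j)
    acc   : Fin (LevelSize width n) → Bool

  var : (j : ℕ) → j < n → Fin n
  var j p = order ⟨$⟩ʳ fromℕ< p

  state : (Fin n → Bool) → (k : ℕ) → k ≤ n → Fin (LevelSize width k)
  state x zero    _ = Fin.zero
  state x (suc k) p = δ k p (state x k (<⇒≤ p)) (x (var k p))

  eval : BoolFun n
  eval x = acc (state x n Data.Nat.Properties.≤-refl)

-- Nondeterministic OBDD: arbitrary sets of labelled edges between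
-- consecutive levels (E j u b v = true iff there is an edge u → v labelled b).
record NOBDD (n : ℕ) : Set where
  field
    order : Permutation′ n
    width : ℕ → ℕ
    E     : (j : ℕ) → j < n → Fin (LevelSize width j) → Bool → Fin (width j) → Bool
    acc   : Fin (LevelSize width n) → Bool

  var : (j : ℕ) → j < n → Fin n
  var j p = order ⟨$⟩ʳ fromℕ< p

  Reach : (Fin n → Bool) → (k : ℕ) → k ≤ n → Fin (LevelSize width k) → Set
  Reach x zero    _ _ = ⊤
  Reach x (suc k) p v =
    Σ (Fin (LevelSize width k)) λ u → Reach x k (<⇒≤ p) u × (E k p u (x (var k p)) v ≡ true)

  Accepts : (Fin n → Bool) → Set
  Accepts x = Σ (Fin (LevelSize width n)) λ v → Reach x n Data.Nat.Properties.≤-refl v × (acc v ≡ true)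

-- width ≤ d : every level has at most d nodes (level 0 has 1 node)
OBDDWidth≤ : ∀ {n} → OBDD n → ℕ → Set
OBDDWidth≤ {n} B d = (1 ≤ d) × (∀ j → j < n → OBDD.width B j ≤ d)

NOBDDWidth≤ : ∀ {n} → NOBDD n → ℕ → Set
NOBDDWidth≤ {n} B d = (1 ≤ d) × (∀ j → j < n → NOBDD.width B j ≤ d)

InOBDD : (n d : ℕ) → BoolFun n → Set
InOBDD n d f = Σ (OBDD n) λ B → OBDDWidth≤ B d × (∀ x → OBDD.eval B x ≡ f x)

InNOBDD : (n d : ℕ) → BoolFun n → Set
InNOBDD n d f = Σ (NOBDD n) λ B → NOBDDWidth≤ B d × (∀ x → (f x ≡ true) ⇔ NOBDD.Accepts B x)

_⊆ᶜ_ : ∀ {n} → (BoolFun n → Set) → (BoolFun n → Set) → Set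
A ⊆ᶜ B = ∀ f → A f → B f

_⊊ᶜ_ : ∀ {n} → (BoolFun n → Set) → (BoolFun n → Set) → Set
A ⊊ᶜ B = (A ⊆ᶜ B) × ∃ λ f → B f × ¬ A f

Incomparable : ∀ {n} → (BoolFun n → Set) → (BoolFun n → Set) → Set
Incomparable A B = ¬ (A ⊆ᶜ B) × ¬ (B ⊆ᶜ A)

{-# OPTIONS --safe #-}
module Submission where

-- Both separating functions check a sequence of stack operations: control bits say
-- which values are pushed and which are popped and compared. Given a variable order,
-- cut it when half of the values have been read, and choose the control bits such
-- that every comparison is between a read and an unread value. The matched
-- assignments form a fooling set of size 2 ^ T for 2 T values, which bounds the width
-- of an NOBDD for the function and of an OBDD for its complement from below.
--
-- With one control bit per value, the function has OBDD width 2 ^ (T + 2): a state is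
-- a stack of height at most T and one bit. The complement has small NOBDD width: guess
-- a pushed value, count what lies above it, and compare it when it is popped. Since
-- the OBDD bound must exceed d when there are only 4 log d variables, here five
-- control bits encode the operations of six values.

open import Defs
open import Data.Nat using (ℕ; zero; suc; _≤_; _<_; _*_; _+_; _^_; _∸_; s≤s; z≤n; _≤?_; _<?_; ⌊_/2⌋; >-nonZero)
open import Data.Nat.Properties
open import Data.Nat.DivMod using (_/_; _%_; m≡m%n+[m/n]*n; m%n<n; m/n*n≤m)
open import Data.Nat.Induction using (<-rec)
open import Data.Nat.Logarithm using (⌊log₂_⌋; ⌊log₂⌋-mono-≤; ⌊log₂[2^n]⌋≡n; ⌊log₂⌊n/2⌋⌋≡⌊log₂n⌋∸1)
open import Data.Nat.Solver using (module +-*-Solver)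
open import Data.Bool using (Bool; true; false; not; _∧_; if_then_else_)
import Data.Bool.Properties as Boolₚ
open import Data.Fin as Fin using (Fin; toℕ; fromℕ<; quotient; remainder; combine; finToFun; funToFin; _↑ʳ_; #_)
open import Data.Fin.Properties as Finₚ using (toℕ-fromℕ<; toℕ<n; toℕ-injective; combine-remQuot; 2↔Bool; injective⇒≤; any?; finToFun-funToFin)
open import Data.Fin.Permutation as Perm using (Permutation′; _⟨$⟩ʳ_; _⟨$⟩ˡ_; inverseˡ; inverseʳ)
open import Data.Maybe using (Maybe; just; nothing)
import Data.Maybe.Properties as Maybeₚ
open import Data.Vec as Vec using (Vec; []; _∷_; toList)
open import Data.Vec.Properties using (length-toList)
open import Data.List using (List; []; _∷_; _++_; _∷ʳ_; length; map; foldl; lookup; tabulate; take; upTo; cartesianProduct)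
open import Data.List.Properties as Listₚ using (∷-injectiveˡ; ∷-injectiveʳ; foldl-∷ʳ; take-suc-tabulate; take-all; length-tabulate; length-map; length-++; length-upTo)
open import Data.List.Relation.Unary.All using (All; []; _∷_)
open import Data.List.Relation.Unary.AllPairs using ([]; _∷_)
open import Data.List.Relation.Unary.Any using (here; there; index)
open import Data.List.Relation.Unary.Any.Properties using (lookup-index)
open import Data.List.Relation.Unary.Unique.Propositional using (Unique)
open import Data.List.Membership.Propositional using (_∈_)
open import Data.List.Membership.Propositional.Properties using (∈-lookup; ∈-map⁺; ∈-map⁻; ∈-++⁺ˡ; ∈-++⁺ʳ; ∈-++⁻; ∈-cartesianProduct⁺; ∈-cartesianProduct⁻; ∈-upTo⁺)
import Data.List.Membership.DecPropositional as DecMembership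
open import Data.Product using (Σ; _×_; ∃; ∃₂; _,_; proj₁; proj₂)
import Data.Product.Properties as Productₚ
open import Data.Sum using (_⊎_; inj₁; inj₂)
open import Data.Unit using (tt)
open import Data.Empty using (⊥; ⊥-elim)
open import Relation.Nullary using (Dec; yes; no; _×-dec_)
open import Relation.Nullary.Decidable using (⌊_⌋)
open import Relation.Binary using (DecidableEquality)
open import Relation.Binary.PropositionalEquality
open import Function using (_∘_; id; _⇔_; mk⇔; Equivalence; Inverse; Injection)
open import Function.Definitions using (Injective)
open import Function.Properties.Inverse using (↔⇒↣)

private variable
  n : ℕ
  A : Set

-- The stack machine

-- run stack marks values: a mark true pushes the current value, a mark false pops and
-- compares.
run : List Bool → List Bool → List Bool → Bool
run st       (true ∷ M)  (v ∷ V) = run (v ∷ st) M V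
run []       []          []      = true
run (u ∷ st) (false ∷ M) (v ∷ V) = ⌊ u Boolₚ.≟ v ⌋ ∧ run st M V
run _        _           _       = false

run-pop : ∀ u st M v V → run (u ∷ st) (false ∷ M) (v ∷ V) ≡ true →
          u ≡ v × run st M V ≡ true
run-pop u _ _ v _ r with u Boolₚ.≟ v
... | yes u≡v = u≡v , r

run-pop⁺ : ∀ u st M V → run st M V ≡ true → run (u ∷ st) (false ∷ M) (u ∷ V) ≡ true
run-pop⁺ u _ _ _ r with u Boolₚ.≟ u
... | yes _  = r
... | no u≢u = ⊥-elim (u≢u refl)

-- Each mark removes at most one value, so a stack higher than the number of remaining marks cannot
-- be emptied. This justifies giving up on high stacks in `StackMachine`.
run-overfull : ∀ st M V → length M < length st → run st M V ≡ false
run-overfull (_ ∷ _)  []          []      _ = refl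
run-overfull (_ ∷ _)  []          (_ ∷ _) _ = refl
run-overfull (_ ∷ _)  (true ∷ _)  []      _ = refl
run-overfull (_ ∷ _)  (false ∷ _) []      _ = refl
run-overfull st@(_ ∷ _) (true ∷ M) (v ∷ V) p =
  run-overfull (v ∷ st) M V (<-trans (n<1+n _) (<-trans p (n<1+n _)))
run-overfull (u ∷ st) (false ∷ M) (v ∷ V) (s≤s p) with u Boolₚ.≟ v
... | yes _ = run-overfull st M V p
... | no  _ = refl

-- Good stack marks sides: the side of a value is true if it is read before the cut.
data Good : List Bool → List Bool → List Bool → Set where
  done : Good [] [] []
  push : ∀ {s σ M L} → Good (s ∷ σ) M L → Good σ (true ∷ M) (s ∷ L)
  pop  : ∀ {s σ M L} → Good σ M L → Good (not s ∷ σ) (false ∷ M) (s ∷ L)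

-- Agreement at the positions of side `t` only: `Agree true` compares value lists before the cut,
-- `Agree false` after it.
data Agree (t : Bool) : (L v w : List Bool) → Set where
  []  : Agree t [] [] []
  _∷_ : ∀ {s a b L v w} → (s ≡ t → a ≡ b) → Agree t L v w → Agree t (s ∷ L) (a ∷ v) (b ∷ w)

agree-sym : ∀ {t L v w} → Agree t L v w → Agree t L w v
agree-sym []       = []
agree-sym (p ∷ ps) = (sym ∘ p) ∷ agree-sym ps

agree-trans : ∀ {t L u v w} → Agree t L u v → Agree t L v w → Agree t L u w
agree-trans []       []       = []
agree-trans (p ∷ ps) (q ∷ qs) = (λ e → trans (p e) (q e)) ∷ agree-trans ps qs

-- Every comparison pairs an early with a late value. Hence the early entries can be prescribed
-- freely and each late one copies its partner; the late entries of `p` and `q` are ignored.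
completion : ∀ {σ M L} → Good σ M L → ∀ {p q} → length p ≡ length σ → length q ≡ length L →
             ∃₂ λ u v → Agree true σ u p × Agree true L v q × run u M v ≡ true
completion done {[]} {[]} _ _ = [] , [] , [] , [] , refl
completion (push g) {p} {b ∷ q} lp lq
  with completion g {b ∷ p} {q} (cong suc lp) (suc-injective lq)
... | a ∷ u , v , e ∷ es , fs , r = u , a ∷ v , es , e ∷ fs , r
completion {M = _ ∷ M} (pop {true} g) {a ∷ p} {b ∷ q} lp lq
  with completion g {p} {q} (suc-injective lp) (suc-injective lq)
... | u , v , es , fs , r = b ∷ u , b ∷ v , (λ ()) ∷ es , (λ _ → refl) ∷ fs , run-pop⁺ b u M v r
completion {M = _ ∷ M} (pop {false} g) {a ∷ p} {b ∷ q} lp lq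
  with completion g {p} {q} (suc-injective lp) (suc-injective lq)
... | u , v , es , fs , r = a ∷ u , a ∷ v , (λ _ → refl) ∷ es , (λ ()) ∷ fs , run-pop⁺ a u M v r

-- Each early value is compared with a late one, so once both runs accept, the common late values
-- force the early ones.
completion-unique : ∀ {σ M L u u′ v v′} → Good σ M L → Agree false σ u u′ → Agree false L v v′ →
                    run u M v ≡ true → run u′ M v′ ≡ true → u ≡ u′ × v ≡ v′
completion-unique done [] [] _ _ = refl , refl
completion-unique (push g) es (f ∷ fs) r r′ with completion-unique g (f ∷ es) fs r r′
... | refl , refl = refl , refl
completion-unique {M = _ ∷ M} {u = a ∷ u} {a′ ∷ u′} {b ∷ v} {b′ ∷ v′} (pop {s} g) (e ∷ es) (f ∷ fs) r r′
  with run-pop a u M b v r | run-pop a′ u′ M b′ v′ r′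
... | refl , q | refl , q′ with completion-unique g es fs q q′ | s
...   | refl , refl | true  with refl ← e refl = refl , refl
...   | refl , refl | false with refl ← f refl = refl , refl

-- Marks for a balanced sequence of sides

count : Bool → List Bool → ℕ
count s []      = 0
count s (t ∷ L) = if ⌊ s Boolₚ.≟ t ⌋ then suc (count s L) else count s L

count-both : ∀ L → count true L + count false L ≡ length L
count-both []          = refl
count-both (true ∷ L)  = cong suc (count-both L)
count-both (false ∷ L) = trans (+-suc _ _) (cong suc (count-both L))

-- A pop followed by a push inside a pair is left out. Three possibilities per pair suffice for
-- every balanced cut and leave room for a shorter coding of the marks.
data PairMark : Bool → Bool → Set where
  match : PairMark true false
  push² : PairMark true true
  pop²  : PairMark false false

data Paired : ℕ → List Bool → Set where
  []  : Paired 0 []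
  _∷_ : ∀ {p q n M} → PairMark p q → Paired n M → Paired (suc n) (p ∷ q ∷ M)

paired-length : ∀ {n M} → Paired n M → length M ≡ n * 2
paired-length []      = refl
paired-length (_ ∷ p) = cong (suc ∘ suc) (paired-length p)

double : ℕ → Bool → List Bool
double zero    s = []
double (suc h) s = s ∷ s ∷ double h s

-- Between pairs the stack holds an even number of values, all of one side `s`. A mixed pair is
-- matched with itself, a pair of side `s` is pushed, and a pair of the other side is popped against
-- the stack. The hypothesis on the counts makes the stack end empty.
paired-marks : ∀ n h s L → length L ≡ n * 2 → count (not s) L ≡ h * 2 + count s L →
               ∃ λ M → Paired n M × Good (double h s) M L
paired-marks zero zero s [] _ _ = [] , [] , done
paired-marks (suc n) h true (true ∷ false ∷ L) l c
  with M , p , g ← paired-marks n h true L (suc-injective (suc-injective l))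
                     (suc-injective (trans c (+-suc _ _)))
  = _ , match ∷ p , push (pop g)
paired-marks (suc n) h true (false ∷ true ∷ L) l c
  with M , p , g ← paired-marks n h true L (suc-injective (suc-injective l))
                     (suc-injective (trans c (+-suc _ _)))
  = _ , match ∷ p , push (pop g)
paired-marks (suc n) h false (true ∷ false ∷ L) l c
  with M , p , g ← paired-marks n h false L (suc-injective (suc-injective l))
                     (suc-injective (trans c (+-suc _ _)))
  = _ , match ∷ p , push (pop g)
paired-marks (suc n) h false (false ∷ true ∷ L) l c
  with M , p , g ← paired-marks n h false L (suc-injective (suc-injective l))
                     (suc-injective (trans c (+-suc _ _)))
  = _ , match ∷ p , push (pop g)
paired-marks (suc n) h true (true ∷ true ∷ L) l c
  with M , p , g ← paired-marks n (suc h) true L (suc-injective (suc-injective l))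
                     (trans c (trans (+-suc _ _) (cong suc (+-suc _ _))))
  = _ , push² ∷ p , push (push g)
paired-marks (suc n) h false (false ∷ false ∷ L) l c
  with M , p , g ← paired-marks n (suc h) false L (suc-injective (suc-injective l))
                     (trans c (trans (+-suc _ _) (cong suc (+-suc _ _))))
  = _ , push² ∷ p , push (push g)
paired-marks (suc n) (suc h) true (false ∷ false ∷ L) l c
  with M , p , g ← paired-marks n h true L (suc-injective (suc-injective l))
                     (suc-injective (suc-injective c))
  = _ , pop² ∷ p , pop (pop g)
paired-marks (suc n) (suc h) false (true ∷ true ∷ L) l c
  with M , p , g ← paired-marks n h false L (suc-injective (suc-injective l))
                     (suc-injective (suc-injective c))
  = _ , pop² ∷ p , pop (pop g)
-- There is nothing to pop against, but an empty stack may change its side.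
paired-marks (suc n) zero true (false ∷ false ∷ L) l c
  with M , p , g ← paired-marks n 1 false L (suc-injective (suc-injective l)) (sym c)
  = _ , push² ∷ p , push (push g)
paired-marks (suc n) zero false (true ∷ true ∷ L) l c
  with M , p , g ← paired-marks n 1 true L (suc-injective (suc-injective l)) (sym c)
  = _ , push² ∷ p , push (push g)

balanced-marks : ∀ n L → length L ≡ n * 2 → count true L ≡ n →
                 ∃ λ M → Paired n M × Good [] M L
balanced-marks n L l c = paired-marks n 0 true L l (+-cancelˡ-≡ (count true L) _ _ (begin
  count true L + count false L ≡⟨ count-both L ⟩
  length L                     ≡⟨ l ⟩
  n * 2                        ≡⟨ *-comm n 2 ⟩
  n + (n + 0)                  ≡⟨ cong (n +_) (+-identityʳ n) ⟩
  n + n                        ≡⟨ cong₂ _+_ c c ⟨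
  count true L + count true L  ∎))
  where open ≡-Reasoning

-- Free early bits and the choice of the cut

-- The `false` at late positions is filler: the result is only ever compared through `Agree true`.
spread : List Bool → (ℕ → Bool) → List Bool
spread []          a = []
spread (true ∷ L)  a = a 0 ∷ spread L (a ∘ suc)
spread (false ∷ L) a = false ∷ spread L a

length-spread : ∀ L a → length (spread L a) ≡ length L
length-spread []          a = refl
length-spread (true ∷ L)  a = cong suc (length-spread L (a ∘ suc))
length-spread (false ∷ L) a = cong suc (length-spread L a)

spread-injective : ∀ L {a b} → Agree true L (spread L a) (spread L b) →
                   ∀ i → i < count true L → a i ≡ b i
spread-injective (true ∷ L)  (e ∷ es) zero    _       = e refl
spread-injective (true ∷ L)  (e ∷ es) (suc i) (s≤s p) = spread-injective L es i p
spread-injective (false ∷ L) (e ∷ es) i       p       = spread-injective L es i p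

below : ℕ → List ℕ → List Bool
below k = map (λ p → ⌊ p <? k ⌋)

count-below-all : ∀ {n ps} → All (_< n) ps → count true (below n ps) ≡ length ps
count-below-all []       = refl
count-below-all {n} {p ∷ _} (p<n ∷ ps<n) with p <? n
... | yes _   = cong suc (count-below-all ps<n)
... | no p≮n = ⊥-elim (p≮n p<n)

count-below-zero : ∀ ps → count true (below 0 ps) ≡ 0
count-below-zero []       = refl
count-below-zero (p ∷ ps) = count-below-zero ps

count-below-absent : ∀ {k ps} → All (k ≢_) ps → count true (below (suc k) ps) ≡ count true (below k ps)
count-below-absent []       = refl
count-below-absent {k} {p ∷ ps} (k≢p ∷ a) with p <? suc k | p <? k
... | yes _     | yes _   = cong suc (count-below-absent a)
... | no _      | no _    = count-below-absent a
... | yes p<1+k | no p≮k = ⊥-elim (k≢p (≤-antisym (≮⇒≥ p≮k) (≤-pred p<1+k)))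
... | no p≮1+k | yes p<k = ⊥-elim (p≮1+k (m<n⇒m<1+n p<k))

count-below-suc : ∀ k {ps} → Unique ps → count true (below (suc k) ps) ≤ suc (count true (below k ps))
count-below-suc k [] = z≤n
count-below-suc k {p ∷ ps} (a ∷ u) with p <? suc k | p <? k
... | yes _     | yes _   = s≤s (count-below-suc k u)
... | no _      | no _    = count-below-suc k u
... | no p≮1+k | yes p<k = ⊥-elim (p≮1+k (m<n⇒m<1+n p<k))
... | yes p<1+k | no p≮k with refl ← ≤-antisym (≮⇒≥ p≮k) (≤-pred p<1+k) =
  s≤s (≤-reflexive (count-below-absent a))

-- A discrete intermediate value argument: the count starts at 0 and, the positions being distinct,
-- grows by at most one per step.
threshold : ∀ n {ps} T → Unique ps → T ≤ count true (below n ps) →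
            ∃ λ k → k ≤ n × count true (below k ps) ≡ T
threshold zero {ps} T u T≤c = 0 , z≤n ,
  trans (count-below-zero ps) (sym (n≤0⇒n≡0 (subst (T ≤_) (count-below-zero ps) T≤c)))
threshold (suc n) {ps} T u T≤c with T ≤? count true (below n ps)
... | yes T≤c′ with k , k≤n , e ← threshold n T u T≤c′ = k , m≤n⇒m≤1+n k≤n , e
... | no T≰c′ = suc n , ≤-refl , ≤-antisym (≤-trans (count-below-suc n u) (≰⇒> T≰c′)) T≤c

-- Fooling sets and width bounds

-- The role of a variable: control bit, value, or padding up to the required number of variables.
data Kind : Set where
  ctl val skip : Kind


ctls vals : Vec Kind n → (Fin n → A) → List A
ctls []         x = []
ctls (ctl ∷ K)  x = x Fin.zero ∷ ctls K (x ∘ Fin.suc)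
ctls (val ∷ K)  x = ctls K (x ∘ Fin.suc)
ctls (skip ∷ K) x = ctls K (x ∘ Fin.suc)
vals []         x = []
vals (ctl ∷ K)  x = vals K (x ∘ Fin.suc)
vals (val ∷ K)  x = x Fin.zero ∷ vals K (x ∘ Fin.suc)
vals (skip ∷ K) x = vals K (x ∘ Fin.suc)

merge : Vec Kind n → List Bool → List Bool → Fin n → Bool
merge (ctl ∷ K)  (b ∷ c) V       Fin.zero    = b
merge (ctl ∷ K)  (b ∷ c) V       (Fin.suc i) = merge K c V i
merge (val ∷ K)  c       (b ∷ V) Fin.zero    = b
merge (val ∷ K)  c       (b ∷ V) (Fin.suc i) = merge K c V i
merge (skip ∷ K) c       V       (Fin.suc i) = merge K c V i
merge _          _       _       _           = false

ctls-merge : ∀ (K : Vec Kind n) {x y : Fin n → A} {c V} →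
             length c ≡ length (ctls K x) → length V ≡ length (vals K y) → ctls K (merge K c V) ≡ c
ctls-merge []         {c = []}            _  _  = refl
ctls-merge (ctl ∷ K)  {c = b ∷ c}         lc lV = cong (b ∷_) (ctls-merge K (suc-injective lc) lV)
ctls-merge (val ∷ K)  {V = b ∷ V}         lc lV = ctls-merge K lc (suc-injective lV)
ctls-merge (skip ∷ K)                     lc lV = ctls-merge K lc lV

vals-merge : ∀ (K : Vec Kind n) {x y : Fin n → A} {c V} →
             length c ≡ length (ctls K x) → length V ≡ length (vals K y) → vals K (merge K c V) ≡ V
vals-merge []         {V = []}            _  _  = refl
vals-merge (ctl ∷ K)  {c = b ∷ c}         lc lV = vals-merge K (suc-injective lc) lV
vals-merge (val ∷ K)  {V = b ∷ V}         lc lV = cong (b ∷_) (vals-merge K lc (suc-injective lV))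
vals-merge (skip ∷ K)                     lc lV = vals-merge K lc lV

length-vals : ∀ {B : Set} (K : Vec Kind n) (x : Fin n → A) (y : Fin n → B) → length (vals K x) ≡ length (vals K y)
length-vals []         x y = refl
length-vals (ctl ∷ K)  x y = length-vals K _ _
length-vals (val ∷ K)  x y = cong suc (length-vals K _ _)
length-vals (skip ∷ K) x y = length-vals K _ _

map-vals : ∀ {B : Set} (f : A → B) (K : Vec Kind n) (x : Fin n → A) → map f (vals K x) ≡ vals K (f ∘ x)
map-vals f []         x = refl
map-vals f (ctl ∷ K)  x = map-vals f K _
map-vals f (val ∷ K)  x = cong (f (x Fin.zero) ∷_) (map-vals f K _)
map-vals f (skip ∷ K) x = map-vals f K _

vals-all : ∀ {P : A → Set} (K : Vec Kind n) {x : Fin n → A} → (∀ v → P (x v)) → All P (vals K x)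
vals-all []         p = []
vals-all (ctl ∷ K)  p = vals-all K (p ∘ Fin.suc)
vals-all (val ∷ K)  p = p Fin.zero ∷ vals-all K (p ∘ Fin.suc)
vals-all (skip ∷ K) p = vals-all K (p ∘ Fin.suc)

vals-unique : ∀ (K : Vec Kind n) {x : Fin n → A} → Injective _≡_ _≡_ x → Unique (vals K x)
vals-unique []         inj = []
vals-unique (ctl ∷ K)  inj = vals-unique K (Finₚ.suc-injective ∘ inj)
vals-unique (val ∷ K)  inj = vals-all K (λ v e → Finₚ.0≢1+n (inj e)) ∷ vals-unique K (Finₚ.suc-injective ∘ inj)
vals-unique (skip ∷ K) inj = vals-unique K (Finₚ.suc-injective ∘ inj)

vals-agree : ∀ {t} (K : Vec Kind n) {s x y : Fin n → Bool} → (∀ v → s v ≡ t → x v ≡ y v) →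
             Agree t (vals K s) (vals K x) (vals K y)
vals-agree []         p = []
vals-agree (ctl ∷ K)  p = vals-agree K (p ∘ Fin.suc)
vals-agree (val ∷ K)  p = p Fin.zero ∷ vals-agree K (p ∘ Fin.suc)
vals-agree (skip ∷ K) p = vals-agree K (p ∘ Fin.suc)

-- Control variables may lie on either side of the cut. Since the two mixed inputs share their
-- control bits, the mixture decodes to the same marks.
ctls-either : ∀ (K : Vec Kind n) {x y z : Fin n → A} → ctls K x ≡ ctls K y →
              (∀ v → z v ≡ x v ⊎ z v ≡ y v) → ctls K z ≡ ctls K y
ctls-either []         e p = refl
ctls-either (val ∷ K)  e p = ctls-either K e (p ∘ Fin.suc)
ctls-either (skip ∷ K) e p = ctls-either K e (p ∘ Fin.suc)
ctls-either (ctl ∷ K) {x} {y} {z} e p = cong₂ _∷_ (z≡y (p Fin.zero)) (ctls-either K (∷-injectiveʳ e) (p ∘ Fin.suc))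
  where
  z≡y : z Fin.zero ≡ x Fin.zero ⊎ z Fin.zero ≡ y Fin.zero → z Fin.zero ≡ y Fin.zero
  z≡y (inj₁ q) = trans q (∷-injectiveˡ e)
  z≡y (inj₂ q) = q

-- Binary digits, most significant first; they index the fooling set by the T free early values.
bit : ∀ T → Fin (2 ^ T) → ℕ → Bool
bit zero    i _       = false
bit (suc T) i zero    = Inverse.to 2↔Bool (quotient {2} (2 ^ T) i)
bit (suc T) i (suc j) = bit T (remainder {2} (2 ^ T) i) j

bit-injective : ∀ T i j → (∀ k → k < T → bit T i k ≡ bit T j k) → i ≡ j
bit-injective zero    Fin.zero Fin.zero _ = refl
bit-injective (suc T) i j p = begin
  i ≡⟨ combine-remQuot {2} (2 ^ T) i ⟨
  combine (quotient {2} (2 ^ T) i) (remainder {2} (2 ^ T) i)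
    ≡⟨ cong₂ combine (Injection.injective (↔⇒↣ 2↔Bool) (p 0 (s≤s z≤n)))
                     (bit-injective T _ _ (λ k k<T → p (suc k) (s≤s k<T))) ⟩
  combine (quotient {2} (2 ^ T) j) (remainder {2} (2 ^ T) j)
    ≡⟨ combine-remQuot {2} (2 ^ T) j ⟩
  j ∎
  where open ≡-Reasoning

-- pos v is the step at which the variable v is read; z is the input that
-- continues the first k steps of X i like X j.
FoolingSets : ℕ → BoolFun n → Set
FoolingSets {n} T h = ∀ (pos : Fin n → ℕ) → Injective _≡_ _≡_ pos → (∀ v → pos v < n) →
  ∃ λ k → k ≤ n × Σ (Fin (2 ^ T) → Fin n → Bool) λ X →
    (∀ i → h (X i) ≡ true) ×
    (∀ i j z → (∀ v → pos v < k → z v ≡ X i v) → (∀ v → k ≤ pos v → z v ≡ X j v) →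
       h z ≡ true → i ≡ j)

stackFun : Vec Kind n → (List Bool → List Bool) → BoolFun n
stackFun K D x = run [] (D (ctls K x)) (vals K x)

agree-length : ∀ {t L v w} → Agree t L v w → length v ≡ length L
agree-length []       = refl
agree-length (_ ∷ ps) = cong suc (agree-length ps)

-- The fooling set for one fixed cut. All inputs carry the control bits `c`; input `i` has the
-- digits of `i` as its early values and the late values that the comparisons force.
module Cut {n : ℕ} (K : Vec Kind n) (D : List Bool → List Bool) (T : ℕ) (pos : Fin n → ℕ) (k : ℕ)
           (c : List Bool) (lenC : length c ≡ length (ctls K pos))
           (countL : count true (vals K (λ v → ⌊ pos v <? k ⌋)) ≡ T)
           (good : Good [] (D c) (vals K (λ v → ⌊ pos v <? k ⌋)))
           where

  early : Fin n → Bool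
  early v = ⌊ pos v <? k ⌋

  L : List Bool
  L = vals K early

  completed : ∀ i → ∃ λ v → Agree true L v (spread L (bit T i)) × run [] (D c) v ≡ true
  completed i with completion good {[]} {spread L (bit T i)} refl (length-spread L (bit T i))
  ... | [] , v , [] , a , r = v , a , r

  V : Fin (2 ^ T) → List Bool
  V i = proj₁ (completed i)

  V-agree : ∀ i → Agree true L (V i) (spread L (bit T i))
  V-agree i = proj₁ (proj₂ (completed i))

  V-run : ∀ i → run [] (D c) (V i) ≡ true
  V-run i = proj₂ (proj₂ (completed i))

  V-length : ∀ i → length (V i) ≡ length (vals K pos)
  V-length i = trans (agree-length (V-agree i)) (length-vals K early pos)

  X : Fin (2 ^ T) → Fin n → Bool
  X i = merge K c (V i)

  ctls-X : ∀ i → ctls K (X i) ≡ c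
  ctls-X i = ctls-merge K lenC (V-length i)

  vals-X : ∀ i → vals K (X i) ≡ V i
  vals-X i = vals-merge K lenC (V-length i)

  accepted : ∀ i → stackFun K D (X i) ≡ true
  accepted i = trans (cong₂ (λ c V → run [] (D c) V) (ctls-X i) (vals-X i)) (V-run i)

  module _ (i j : Fin (2 ^ T)) (z : Fin n → Bool)
           (zi : ∀ v → pos v < k → z v ≡ X i v) (zj : ∀ v → k ≤ pos v → z v ≡ X j v) where

    early-z : ∀ v → early v ≡ true → z v ≡ X i v
    early-z v e with pos v <? k
    ... | yes p = zi v p

    late-z : ∀ v → early v ≡ false → z v ≡ X j v
    late-z v e with pos v <? k
    ... | no p = zj v (≮⇒≥ p)

    either-z : ∀ v → z v ≡ X i v ⊎ z v ≡ X j v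
    either-z v with pos v <? k
    ... | yes p = inj₁ (zi v p)
    ... | no p  = inj₂ (zj v (≮⇒≥ p))

    ctls-z : ctls K z ≡ c
    ctls-z = trans (ctls-either K (trans (ctls-X i) (sym (ctls-X j))) either-z) (ctls-X j)

    -- The late values of `z` are those of `X j`, so acceptance makes all its values those of `X j`.
    -- Its early values are those of `X i`; hence the digits of `i` and `j` coincide.
    separated : stackFun K D z ≡ true → i ≡ j
    separated hz = bit-injective T i j (λ b b<T →
        spread-injective L spreads b (subst (b <_) (sym countL) b<T))
      where
      run-z : run [] (D c) (vals K z) ≡ true
      run-z = subst (λ c → run [] (D c) (vals K z) ≡ true) ctls-z hz

      z≡Vj : vals K z ≡ V j
      z≡Vj = proj₂ (completion-unique good []
        (subst (Agree false L (vals K z)) (vals-X j) (vals-agree K late-z)) run-z (V-run j))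

      Vj-Vi : Agree true L (V j) (V i)
      Vj-Vi = subst₂ (Agree true L) z≡Vj (vals-X i) (vals-agree K early-z)

      spreads : Agree true L (spread L (bit T i)) (spread L (bit T j))
      spreads = agree-trans (agree-sym (V-agree i)) (agree-trans (agree-sym Vj-Vi) (V-agree j))

-- For a given order the cut comes after T of the 2 T values. The sides are then balanced, which
-- yields suitable marks, and `code` supplies control bits that decode to them.
stackFun-fooling : ∀ (K : Vec Kind n) D T → (∀ {A} (x : Fin n → A) → length (vals K x) ≡ T * 2) →
  (∀ M → Paired T M → ∃ λ c → D c ≡ M × (∀ {A} (x : Fin n → A) → length c ≡ length (ctls K x))) →
  FoolingSets T (stackFun K D)
stackFun-fooling {n} K D T lenV code pos inj pos<n
  -- All 2 T values have been read by step n, so the count reaches T.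
  with k , k≤n , cnt ← threshold n T (vals-unique K inj)
         (subst (T ≤_) (sym (trans (count-below-all (vals-all K pos<n)) (lenV pos))) (m≤m*n T 2))
  with cnt′ ← trans (cong (count true) (sym (map-vals (λ p → ⌊ p <? k ⌋) K pos))) cnt
  with M , p , good ← balanced-marks T (vals K (λ v → ⌊ pos v <? k ⌋)) (lenV _) cnt′
  with c , refl , lenC ← code M p
  = k , k≤n , Cut.X K D T pos k c (lenC pos) cnt′ good
  , Cut.accepted K D T pos k c (lenC pos) cnt′ good
  , Cut.separated K D T pos k c (lenC pos) cnt′ good

-- Cutting diagrams at a level

module _ (π : Permutation′ n) where

  position : Fin n → ℕ
  position v = toℕ (π ⟨$⟩ˡ v)

  position-injective : Injective _≡_ _≡_ position
  position-injective {u} {v} e = begin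
    u                   ≡⟨ inverseʳ π ⟨
    π ⟨$⟩ʳ (π ⟨$⟩ˡ u)   ≡⟨ cong (π ⟨$⟩ʳ_) (toℕ-injective e) ⟩
    π ⟨$⟩ʳ (π ⟨$⟩ˡ v)   ≡⟨ inverseʳ π ⟩
    v                   ∎
    where open ≡-Reasoning

  position-var : ∀ {k} (p : k < n) → position (π ⟨$⟩ʳ fromℕ< p) ≡ k
  position-var p = trans (cong toℕ (inverseˡ π)) (toℕ-fromℕ< p)

  splice : ℕ → (x y : Fin n → Bool) → Fin n → Bool
  splice k x y v = if ⌊ position v <? k ⌋ then x v else y v

  splice-< : ∀ k x y v → position v < k → splice k x y v ≡ x v
  splice-< k x y v p with position v <? k
  ... | yes _ = refl
  ... | no ¬p = ⊥-elim (¬p p)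

  splice-≥ : ∀ k x y v → k ≤ position v → splice k x y v ≡ y v
  splice-≥ k x y v p with position v <? k
  ... | yes q = ⊥-elim (<⇒≱ q p)
  ... | no _  = refl

levelSize-≤ : ∀ {w d k} → 1 ≤ d → (∀ j → j < n → w j ≤ d) → k ≤ n → LevelSize w k ≤ d
levelSize-≤ {k = zero}  1≤d _ _ = 1≤d
levelSize-≤ {k = suc k} _   b p = b k p

module _ (B : OBDD n) where
  open OBDD B

  state-prefix : ∀ {x y} k p → (∀ v → position order v < k → x v ≡ y v) → state x k p ≡ state y k p
  state-prefix zero    p e = refl
  state-prefix (suc k) p e = cong₂ (δ k p)
    (state-prefix k _ (λ v q → e v (m<n⇒m<1+n q)))
    (e _ (s≤s (≤-reflexive (position-var order p))))

  state-suffix : ∀ {x y k m} → k ≤ m → ∀ p q → (∀ v → k ≤ position order v → x v ≡ y v) →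
                 state x k p ≡ state y k p → state x m q ≡ state y m q
  state-suffix {x} {y} {k} {m} k≤m p q e s with m≤n⇒m<n∨m≡n k≤m
  -- The state depends on a proof of `m ≤ n`; any two such proofs are equal.
  ... | inj₂ refl = subst (λ r → state x m r ≡ state y m r) (≤-irrelevant p q) s
  state-suffix {m = suc m} k≤m p q e s | inj₁ (s≤s k≤m′) = cong₂ (δ m q)
    (state-suffix k≤m′ p _ e s)
    (e _ (subst (_ ≤_) (sym (position-var order q)) k≤m′))

-- The fooling inputs reach distinct nodes at the cut: if `X i` and `X j` met, the spliced input
-- would end where `X j` ends. Determinism makes this work for rejection as well, hence for the
-- complement of `h`.
obdd-lower-bound : ∀ {T d} {h : BoolFun n} → FoolingSets T h → InOBDD n d (not ∘ h) → 2 ^ T ≤ d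
obdd-lower-bound {n} {h = h} fool (B , (1≤d , w≤d) , comp)
  with k , k≤n , X , acc-X , sep ← fool (position (OBDD.order B)) (position-injective (OBDD.order B)) (λ v → toℕ<n _)
  = ≤-trans (injective⇒≤ {f = λ i → state (X i) k k≤n} inj) (levelSize-≤ {k = k} 1≤d w≤d k≤n)
  where
  open OBDD B
  inj : Injective _≡_ _≡_ (λ i → state (X i) k k≤n)
  inj {i} {j} e = sep i j z (splice-< order k _ _) (splice-≥ order k _ _) (Boolₚ.not-injective (begin
      not (h z)     ≡⟨ comp z ⟨
      eval z        ≡⟨ cong acc (state-suffix B k≤n k≤n ≤-refl (splice-≥ order k _ _)
                         (trans (state-prefix B k k≤n (splice-< order k _ _)) e)) ⟩
      eval (X j)    ≡⟨ comp (X j) ⟩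
      not (h (X j)) ≡⟨ cong not (acc-X j) ⟩
      false         ∎))
    where
    open ≡-Reasoning
    z = splice order k (X i) (X j)

module _ (B : NOBDD n) where
  open NOBDD B

  reach-prefix : ∀ {x y} k p {v} → (∀ u → position order u < k → x u ≡ y u) → Reach x k p v → Reach y k p v
  reach-prefix zero    p e r = tt
  reach-prefix (suc k) p {v} e (u , r , edge) =
    u , reach-prefix k _ (λ w q → e w (m<n⇒m<1+n q)) r ,
    subst (λ b → E k p u b v ≡ true) (e _ (s≤s (≤-reflexive (position-var order p)))) edge

  -- Splits a path at level `k`. The part after `u` remains valid for every input that agrees with
  -- `x` on the variables read later.
  reach-through : ∀ {x k m} → k ≤ m → ∀ p q {v} → Reach x m q v → ∃ λ u → Reach x k p u ×
    (∀ y → (∀ w → k ≤ position order w → x w ≡ y w) → Reach y k p u → Reach y m q v)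
  reach-through {x} {k} {m} k≤m p q {v} r with m≤n⇒m<n∨m≡n k≤m
  ... | inj₂ refl = v , subst (λ s → Reach x m s v) (≤-irrelevant q p) r ,
                    λ y _ → subst (λ s → Reach y m s v) (≤-irrelevant p q)
  reach-through {x} {k} {suc m} k≤m p q {v} (u , r , edge) | inj₁ (s≤s k≤m′)
    with t , rt , cont ← reach-through k≤m′ p _ r
    = t , rt , λ y e ry → u , cont y e ry ,
      subst (λ b → E m q u b v ≡ true) (e _ (subst (_ ≤_) (sym (position-var order q)) k≤m′)) edge

-- One accepting path is fixed for each fooling input. If two of them share the node at the cut, the
-- first half of one and the second half of the other form an accepting path for the spliced input.
nobdd-lower-bound : ∀ {T d} {h : BoolFun n} → FoolingSets T h → InNOBDD n d h → 2 ^ T ≤ d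
nobdd-lower-bound {n} {T} {h = h} fool (B , (1≤d , w≤d) , comp)
  with k , k≤n , X , acc-X , sep ← fool (position (NOBDD.order B)) (position-injective (NOBDD.order B)) (λ v → toℕ<n _)
  = ≤-trans (injective⇒≤ {f = proj₁ ∘ through} inj) (levelSize-≤ {k = k} 1≤d w≤d k≤n)
  where
  open NOBDD B

  path : ∀ i → Accepts (X i)
  path i = Equivalence.to (comp (X i)) (acc-X i)

  through : ∀ i → ∃ λ u → Reach (X i) k k≤n u × (∀ y → (∀ w → k ≤ position order w → X i w ≡ y w) →
              Reach y k k≤n u → Reach y n ≤-refl (proj₁ (path i)))
  through i = reach-through B k≤n k≤n ≤-refl (proj₁ (proj₂ (path i)))

  inj : Injective _≡_ _≡_ (proj₁ ∘ through)
  inj {i} {j} e = sep i j z (splice-< order k _ _) (splice-≥ order k _ _) (Equivalence.from (comp z)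
      ( proj₁ (path j)
      , proj₂ (proj₂ (through j)) z (λ w q → sym (splice-≥ order k (X i) (X j) w q))
          (subst (Reach z k k≤n) e
            (reach-prefix B k k≤n (λ w q → sym (splice-< order k (X i) (X j) w q)) (proj₁ (proj₂ (through i)))))
      , proj₂ (proj₂ (path j)) ))
    where z = splice order k (X i) (X j)

-- Diagrams from automata

word : Vec Kind n → (Fin n → Bool) → List (Kind × Bool)
word K x = tabulate (λ v → Vec.lookup K v , x v)

take-suc-word : ∀ (K : Vec Kind n) x {k} (p : k < n) →
  take (suc k) (word K x) ≡ take k (word K x) ∷ʳ (Vec.lookup K (fromℕ< p) , x (fromℕ< p))
take-suc-word K x p = subst
  (λ m → take (suc m) (word K x) ≡ take m (word K x) ∷ʳ (Vec.lookup K (fromℕ< p) , x (fromℕ< p)))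
  (toℕ-fromℕ< p) (take-suc-tabulate (λ v → Vec.lookup K v , x v) (fromℕ< p))

take-word : ∀ (K : Vec Kind n) x → take n (word K x) ≡ word K x
take-word {n} K x = take-all n (word K x) (≤-reflexive (length-tabulate (λ v → Vec.lookup K v , x v)))

-- An automaton whose transition depends on the role of the variable becomes a diagram in the
-- natural order. After the source each level has one node per entry of `states`, so the width is
-- `length states`.
module DetMachine {A : Set} (step : Kind → A → Bool → A) (start : A) (accept : A → Bool) (states : List A)
                  (start∈ : start ∈ states)
                  (closed : ∀ κ {a} b → a ∈ states → step κ a b ∈ states) where

  exec : Vec Kind n → (Fin n → Bool) → A → A
  exec []      x a = a
  exec (κ ∷ K) x a = exec K (x ∘ Fin.suc) (step κ a (x Fin.zero))

  exec-word : ∀ (K : Vec Kind n) x a → foldl (λ a (κ , b) → step κ a b) a (word K x) ≡ exec K x a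
  exec-word []      x a = refl
  exec-word (κ ∷ K) x a = exec-word K (x ∘ Fin.suc) _

  node : ∀ j → Fin (LevelSize (λ _ → length states) j) → ∃ (_∈ states)
  node zero    _ = start , start∈
  node (suc j) i = lookup states i , ∈-lookup i

  machine : Vec Kind n → OBDD n
  machine {n} K = record
    { order = Perm.id
    ; width = λ _ → length states
    ; δ     = λ j p u b → index (closed (Vec.lookup K (fromℕ< p)) b (proj₂ (node j u)))
    ; acc   = accept ∘ proj₁ ∘ node n
    }

  state-exec : ∀ (K : Vec Kind n) x k p →
    proj₁ (node k (OBDD.state (machine K) x k p)) ≡ foldl (λ a (κ , b) → step κ a b) start (take k (word K x))
  state-exec K x zero    p = refl
  state-exec K x (suc k) p = begin
    proj₁ (node (suc k) (OBDD.state (machine K) x (suc k) p))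
      ≡⟨ lookup-index (closed κ b (proj₂ (node k s))) ⟨
    step κ (proj₁ (node k s)) b
      ≡⟨ cong (λ a → step κ a b) (state-exec K x k _) ⟩
    step κ (foldl f start (take k (word K x))) b
      ≡⟨ foldl-∷ʳ f start (κ , b) (take k (word K x)) ⟨
    foldl f start (take k (word K x) ∷ʳ (κ , b))
      ≡⟨ cong (foldl f start) (take-suc-word K x p) ⟨
    foldl f start (take (suc k) (word K x)) ∎
    where
    open ≡-Reasoning
    f : A → Kind × Bool → A
    f a (κ , b) = step κ a b
    κ = Vec.lookup K (fromℕ< p)
    b = x (fromℕ< p)
    s = OBDD.state (machine K) x k (<⇒≤ p)

  machine-eval : ∀ (K : Vec Kind n) x → OBDD.eval (machine K) x ≡ accept (exec K x start)
  machine-eval {n} K x = cong accept (trans (state-exec K x n ≤-refl)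
    (trans (cong (foldl _ start) (take-word K x)) (exec-word K x start)))

  machine-inOBDD : ∀ (K : Vec Kind n) {f} → (∀ x → accept (exec K x start) ≡ f x) → InOBDD n (length states) f
  machine-inOBDD K e = machine K , (nonempty start∈ , λ _ _ → ≤-refl) , λ x → trans (machine-eval K x) (e x)
    where
    nonempty : ∀ {a} {as : List A} → a ∈ as → 1 ≤ length as
    nonempty (here _)  = s≤s z≤n
    nonempty (there _) = s≤s z≤n

module NondetMachine {A : Set} (_≟_ : DecidableEquality A) (succs : Kind → A → Bool → List A) (start : A)
                     (accept : A → Bool) (states : List A) where

  open DecMembership _≟_ using (_∈?_)

  -- Successors must lie in `states`, since only these have nodes in the diagram.
  Acc : Vec Kind n → (Fin n → Bool) → A → Set
  Acc []      x a = accept a ≡ true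
  Acc (κ ∷ K) x a = ∃ λ a′ → a′ ∈ succs κ a (x Fin.zero) × a′ ∈ states × Acc K (x ∘ Fin.suc) a′

  -- Mediates between `Acc`, which consumes the input from the front, and `Reach`, which is defined
  -- from the last step.
  data Path : A → List (Kind × Bool) → A → Set where
    []   : ∀ {a} → Path a [] a
    step : ∀ {κ b zs a a′ a″} → a′ ∈ succs κ a b → a′ ∈ states → Path a′ zs a″ → Path a ((κ , b) ∷ zs) a″

  path-∷ʳ : ∀ {κ b zs a a′ a″} → Path a zs a′ → a″ ∈ succs κ a′ b → a″ ∈ states → Path a (zs ∷ʳ (κ , b)) a″
  path-∷ʳ []             s m = step s m []
  path-∷ʳ (step s′ m′ P) s m = step s′ m′ (path-∷ʳ P s m)

  path-unsnoc : ∀ {κ b} zs {a a″} → Path a (zs ∷ʳ (κ , b)) a″ →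
                ∃ λ a′ → Path a zs a′ × a″ ∈ succs κ a′ b × a″ ∈ states
  path-unsnoc []       (step s m [])  = _ , [] , s , m
  path-unsnoc (_ ∷ zs) (step s′ m′ P) with a′ , P′ , s , m ← path-unsnoc zs P = a′ , step s′ m′ P′ , s , m

  acc⇒path : ∀ (K : Vec Kind n) x {a} → Acc K x a → ∃ λ a′ → Path a (word K x) a′ × accept a′ ≡ true
  acc⇒path []      x e = _ , [] , e
  acc⇒path (κ ∷ K) x (_ , s , m , r) with a′ , P , e ← acc⇒path K (x ∘ Fin.suc) r = a′ , step s m P , e

  path⇒acc : ∀ (K : Vec Kind n) x {a a′} → Path a (word K x) a′ → accept a′ ≡ true → Acc K x a
  path⇒acc []      x []           e = e
  path⇒acc (κ ∷ K) x (step s m P) e = _ , s , m , path⇒acc K (x ∘ Fin.suc) P e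

  node : ∀ j → Fin (LevelSize (λ _ → length states) j) → A
  node zero    _ = start
  node (suc j) i = lookup states i

  machine : Vec Kind n → NOBDD n
  machine {n} K = record
    { order = Perm.id
    ; width = λ _ → length states
    ; E     = λ j p u b v → ⌊ lookup states v ∈? succs (Vec.lookup K (fromℕ< p)) (node j u) b ⌋
    ; acc   = accept ∘ node n
    }

  reach⇒path : ∀ (K : Vec Kind n) x k p v → NOBDD.Reach (machine K) x k p v → Path start (take k (word K x)) (node k v)
  reach⇒path K x zero    p v _ = []
  reach⇒path K x (suc k) p v (u , r , e)
    with lookup states v ∈? succs (Vec.lookup K (fromℕ< p)) (node k u) (x (fromℕ< p))
  ... | yes s = subst (λ zs → Path start zs (lookup states v)) (sym (take-suc-word K x p))
                  (path-∷ʳ (reach⇒path K x k _ u r) s (∈-lookup v))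

  path⇒reach : ∀ (K : Vec Kind n) x k p {a} → Path start (take k (word K x)) a →
               ∃ λ v → node k v ≡ a × NOBDD.Reach (machine K) x k p v
  path⇒reach K x zero    p [] = Fin.zero , refl , tt
  path⇒reach K x (suc k) p {a} P
    with a′ , P′ , s , m ← path-unsnoc (take k (word K x)) (subst (λ zs → Path start zs a) (take-suc-word K x p) P)
    with u , refl , r ← path⇒reach K x k (<⇒≤ p) P′
    = index m , sym (lookup-index m) , u , r , edge
    where
    edge : ⌊ lookup states (index m) ∈? succs (Vec.lookup K (fromℕ< p)) (node k u) (x (fromℕ< p)) ⌋ ≡ true
    edge with lookup states (index m) ∈? succs (Vec.lookup K (fromℕ< p)) (node k u) (x (fromℕ< p))
    ... | yes _ = refl
    ... | no ∉  = ⊥-elim (∉ (subst (_∈ succs (Vec.lookup K (fromℕ< p)) (node k u) (x (fromℕ< p))) (lookup-index m) s))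

  machine-inNOBDD : ∀ (K : Vec Kind n) {f} → 1 ≤ length states → (∀ x → f x ≡ true ⇔ Acc K x start) →
                    InNOBDD n (length states) f
  machine-inNOBDD {n} K {f} ne e = machine K , (ne , λ _ _ → ≤-refl) , λ x → mk⇔ (to x) (from x)
    where
    to : ∀ x → f x ≡ true → NOBDD.Accepts (machine K) x
    to x fx
      with a , P , ok ← acc⇒path K x (Equivalence.to (e x) fx)
      with v , refl , r ← path⇒reach K x n ≤-refl (subst (λ zs → Path start zs a) (sym (take-word K x)) P)
      = v , r , ok
    from : ∀ x → NOBDD.Accepts (machine K) x → f x ≡ true
    from x (v , r , ok) = Equivalence.from (e x) (path⇒acc K x
      (subst (λ zs → Path start zs (node n v)) (take-word K x) (reach⇒path K x n ≤-refl v r)) ok)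

-- Determinisation by subsets

module Powerset (B : NOBDD n) where
  open NOBDD B

  reached : ∀ j → Fin (LevelSize (λ i → 2 ^ width i) j) → Fin (LevelSize width j) → Fin 2
  -- Level 0 has one node rather than 2 ^ 1; it stands for the set containing the source.
  reached zero    _ _ = Fin.suc Fin.zero
  reached (suc j) U   = finToFun U

  char : {P : Set} → Dec P → Fin 2
  char (yes _) = Fin.suc Fin.zero
  char (no  _) = Fin.zero

  char⇒ : ∀ {P : Set} (P? : Dec P) → char P? ≡ Fin.suc Fin.zero → P
  char⇒ (yes p) _ = p

  char⇐ : ∀ {P : Set} (P? : Dec P) → P → char P? ≡ Fin.suc Fin.zero
  char⇐ (yes _) _ = refl
  char⇐ (no ¬p) p = ⊥-elim (¬p p)

  edge? : ∀ j p U b v → Dec (∃ λ u → reached j U u ≡ Fin.suc Fin.zero × E j p u b v ≡ true)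
  edge? j p U b v = any? (λ u → (reached j U u Finₚ.≟ Fin.suc Fin.zero) ×-dec (E j p u b v Boolₚ.≟ true))

  acc? : ∀ U → Dec (∃ λ v → reached n U v ≡ Fin.suc Fin.zero × acc v ≡ true)
  acc? U = any? (λ v → (reached n U v Finₚ.≟ Fin.suc Fin.zero) ×-dec (acc v Boolₚ.≟ true))

  powerset : OBDD n
  powerset = record
    { order = order
    ; width = λ j → 2 ^ width j
    ; δ     = λ j p U b → funToFin (λ v → char (edge? j p U b v))
    ; acc   = λ U → ⌊ acc? U ⌋
    }

  reach⇒reached : ∀ x k p v → Reach x k p v → reached k (OBDD.state powerset x k p) v ≡ Fin.suc Fin.zero
  reach⇒reached x zero    p v _ = refl
  reach⇒reached x (suc k) p v (u , r , e) = trans (finToFun-funToFin _ v)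
    (char⇐ (edge? k p _ _ v) (u , reach⇒reached x k _ u r , e))

  reached⇒reach : ∀ x k p v → reached k (OBDD.state powerset x k p) v ≡ Fin.suc Fin.zero → Reach x k p v
  reached⇒reach x zero    p v _ = tt
  reached⇒reach x (suc k) p v e
    with u , r , e′ ← char⇒ (edge? k p _ _ v) (trans (sym (finToFun-funToFin _ v)) e)
    = u , reached⇒reach x k _ u r , e′

  powerset-eval : ∀ x {b} → (b ≡ true ⇔ Accepts x) → OBDD.eval powerset x ≡ b
  powerset-eval x {b} b⇔ with acc? (OBDD.state powerset x n ≤-refl)
  powerset-eval x {b} b⇔ | yes (v , r , ok) = sym (Equivalence.from b⇔ (v , reached⇒reach x n ≤-refl v r , ok))
  powerset-eval x {false} b⇔ | no ¬acc = refl
  powerset-eval x {true}  b⇔ | no ¬acc with v , r , ok ← Equivalence.to b⇔ refl =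
    ⊥-elim (¬acc (v , reach⇒reached x n ≤-refl v r , ok))

-- The subset construction exponentiates the width; for `w` the rounded logarithm of `d` this is the
-- inclusion in (i).
powerset-inOBDD : ∀ {w d} {f : BoolFun n} → 2 ^ w ≤ d → InNOBDD n w f → InOBDD n d f
powerset-inOBDD {w = w} 2^w≤d (B , (_ , w≤) , comp) =
  Powerset.powerset B
  , (≤-trans (m^n>0 2 w) 2^w≤d , λ j p → ≤-trans (^-monoʳ-≤ 2 (w≤ j p)) 2^w≤d)
  , λ x → Powerset.powerset-eval B x (comp x)

inOBDD-mono : ∀ {d e} {f : BoolFun n} → d ≤ e → InOBDD n d f → InOBDD n e f
inOBDD-mono d≤e (B , (1≤d , w≤d) , comp) = B , (≤-trans 1≤d d≤e , λ j p → ≤-trans (w≤d j p) d≤e) , comp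

inNOBDD-mono : ∀ {d e} {f : BoolFun n} → d ≤ e → InNOBDD n d f → InNOBDD n e f
inNOBDD-mono d≤e (B , (1≤d , w≤d) , comp) = B , (≤-trans 1≤d d≤e , λ j p → ≤-trans (w≤d j p) d≤e) , comp

-- Words of bounded length and padding

words : ℕ → List (List Bool)
words zero    = [] ∷ []
words (suc k) = [] ∷ map (true ∷_) (words k) ++ map (false ∷_) (words k)

-- There are 2 ^ (k + 1) - 1 such words; in `StackMachine` the dead state `nothing` supplies the
-- missing one.
length-words : ∀ k → suc (length (words k)) ≡ 2 ^ suc k
length-words zero    = refl
length-words (suc k) = begin
  2 + length (map (true ∷_) (words k) ++ map (false ∷_) (words k))
    ≡⟨ cong (2 +_) (trans (length-++ (map (true ∷_) (words k))) (cong₂ _+_ (length-map _ (words k)) (length-map _ (words k)))) ⟩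
  2 + (length (words k) + length (words k))
    ≡⟨ cong suc (+-suc _ _) ⟨
  suc (length (words k)) + suc (length (words k))
    ≡⟨ cong₂ _+_ (length-words k) (length-words k) ⟩
  2 ^ suc k + 2 ^ suc k
    ≡⟨ cong (2 ^ suc k +_) (+-identityʳ _) ⟨
  2 ^ suc (suc k) ∎
  where open ≡-Reasoning

∈-words⁺ : ∀ k {l} → length l ≤ k → l ∈ words k
∈-words⁺ zero    {[]}        _       = here refl
∈-words⁺ (suc k) {[]}        _       = here refl
∈-words⁺ (suc k) {true ∷ l}  (s≤s p) = there (∈-++⁺ˡ (∈-map⁺ _ (∈-words⁺ k p)))
∈-words⁺ (suc k) {false ∷ l} (s≤s p) = there (∈-++⁺ʳ (map (true ∷_) (words k)) (∈-map⁺ _ (∈-words⁺ k p)))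

∈-words⁻ : ∀ k {l} → l ∈ words k → length l ≤ k
∈-words⁻ zero    (here refl) = z≤n
∈-words⁻ (suc k) (here refl) = z≤n
∈-words⁻ (suc k) (there m) with ∈-++⁻ (map (true ∷_) (words k)) m
... | inj₁ m′ with l , l∈ , refl ← ∈-map⁻ _ m′ = s≤s (∈-words⁻ k l∈)
... | inj₂ m′ with l , l∈ , refl ← ∈-map⁻ _ m′ = s≤s (∈-words⁻ k l∈)

skips : ∀ r → Vec Kind r
skips r = Vec.replicate r skip

ctls-skips : ∀ r (x : Fin r → A) → ctls (skips r) x ≡ []
ctls-skips zero    x = refl
ctls-skips (suc r) x = ctls-skips r _

vals-skips : ∀ r (x : Fin r → A) → vals (skips r) x ≡ []
vals-skips zero    x = refl
vals-skips (suc r) x = vals-skips r _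

-- One mark per value

markedK : ∀ B r → Vec Kind (B * 2 + r)
markedK zero    r = skips r
markedK (suc B) r = ctl ∷ val ∷ markedK B r

length-ctls-markedK : ∀ B r (x : Fin (B * 2 + r) → A) → length (ctls (markedK B r) x) ≡ B
length-ctls-markedK zero    r x = cong length (ctls-skips r x)
length-ctls-markedK (suc B) r x = cong suc (length-ctls-markedK B r _)

length-vals-markedK : ∀ B r (x : Fin (B * 2 + r) → A) → length (vals (markedK B r) x) ≡ B
length-vals-markedK zero    r x = cong length (vals-skips r x)
length-vals-markedK (suc B) r x = cong suc (length-vals-markedK B r _)

markedFun : ∀ t r → BoolFun (t * 2 * 2 + r)
markedFun t r = stackFun (markedK (t * 2) r) id

markedFun-fooling : ∀ t r → FoolingSets t (markedFun t r)
markedFun-fooling t r = stackFun-fooling (markedK (t * 2) r) id t (length-vals-markedK (t * 2) r)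
  (λ M p → M , refl , λ x → trans (paired-length p) (sym (length-ctls-markedK (t * 2) r x)))

-- A mark is stored on top of the stack until its value arrives, so that stack
-- and mark together are a word of length at most t + 1.
module StackMachine (t : ℕ) where

  step : Kind → Maybe (List Bool) → Bool → Maybe (List Bool)
  step skip a                      _ = a
  step ctl  (just l)               b = if ⌊ length l ≤? t ⌋ then just (b ∷ l) else nothing
  step val  (just (true ∷ l))      v = just (v ∷ l)
  step val  (just (false ∷ u ∷ l)) v = if ⌊ u Boolₚ.≟ v ⌋ then just l else nothing
  step _    _                      _ = nothing

  accept : Maybe (List Bool) → Bool
  accept (just []) = true
  accept _         = false

  states : List (Maybe (List Bool))
  states = nothing ∷ map just (words (suc t))

  just∈ : ∀ {l} → length l ≤ suc t → just l ∈ states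
  just∈ p = there (∈-map⁺ just (∈-words⁺ (suc t) p))

  ∈just : ∀ {l} → just l ∈ states → length l ≤ suc t
  ∈just (there m) with _ , l∈ , refl ← ∈-map⁻ just m = ∈-words⁻ (suc t) l∈

  closed : ∀ κ {a} b → a ∈ states → step κ a b ∈ states
  closed skip                           b m = m
  closed ctl {nothing}                  b m = here refl
  closed ctl {just l}                   b m with length l ≤? t
  ... | yes p = just∈ (s≤s p)
  ... | no _  = here refl
  closed val {nothing}                  b m = here refl
  closed val {just []}                  b m = here refl
  closed val {just (true ∷ l)}          b m = just∈ (∈just m)
  closed val {just (false ∷ [])}        b m = here refl
  closed val {just (false ∷ u ∷ l)}     b m with u Boolₚ.≟ b
  ... | yes _ = just∈ (≤-trans (≤-trans (n≤1+n _) (n≤1+n _)) (∈just m))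
  ... | no _  = here refl

  open DetMachine step (just []) accept states (just∈ z≤n) closed public

  exec-skips : ∀ r x a → exec (skips r) x a ≡ a
  exec-skips zero    x a = refl
  exec-skips (suc r) x a = exec-skips r _ a

  exec-nothing : ∀ (K : Vec Kind n) x → accept (exec K x nothing) ≡ false
  exec-nothing []         x = refl
  exec-nothing (ctl ∷ K)  x = exec-nothing K _
  exec-nothing (val ∷ K)  x = exec-nothing K _
  exec-nothing (skip ∷ K) x = exec-nothing K _

  -- The machine dies at a control bit when the stack is higher than `t`. By the length hypothesis
  -- at most `t` marks then remain, so the unbounded run rejects too.
  exec-run : ∀ B r x l → length l + B ≤ t * 2 →
             accept (exec (markedK B r) x (just l)) ≡ run l (ctls (markedK B r) x) (vals (markedK B r) x)
  exec-run zero r x l p rewrite exec-skips r x (just l) | ctls-skips r x | vals-skips r x with l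
  ... | []    = refl
  ... | _ ∷ _ = refl
  exec-run (suc B) r x l p with length l ≤? t
  ... | no l≰t = trans (exec-nothing (markedK B r) _) (sym (run-overfull l (b ∷ M) (v ∷ V) (begin-strict
      suc (length M)     ≡⟨ cong suc (length-ctls-markedK B r _) ⟩
      suc B              ≤⟨ +-cancelˡ-≤ t _ _ (begin
        t + suc B          ≤⟨ +-monoˡ-≤ (suc B) (<⇒≤ (≰⇒> l≰t)) ⟩
        length l + suc B   ≤⟨ p ⟩
        t * 2              ≡⟨ *-comm t 2 ⟩
        t + (t + 0)        ≡⟨ cong (t +_) (+-identityʳ t) ⟩
        t + t              ∎) ⟩
      t                  <⟨ ≰⇒> l≰t ⟩
      length l           ∎)))
    where
    open ≤-Reasoning
    b = x Fin.zero
    v = x (Fin.suc Fin.zero)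
    M = ctls (markedK B r) (x ∘ Fin.suc ∘ Fin.suc)
    V = vals (markedK B r) (x ∘ Fin.suc ∘ Fin.suc)
  ... | yes _ with x Fin.zero | l
  ...   | true  | l     = exec-run B r _ (x (Fin.suc Fin.zero) ∷ l) (subst (_≤ t * 2) (+-suc (length l) B) p)
  ...   | false | []    = exec-nothing (markedK B r) _
  ...   | false | u ∷ l with u Boolₚ.≟ x (Fin.suc Fin.zero)
  ...     | yes _ = exec-run B r _ l (≤-trans (+-mono-≤ (n≤1+n (length l)) (n≤1+n B)) p)
  ...     | no _  = exec-nothing (markedK B r) _

markedFun-inOBDD : ∀ t r → InOBDD (t * 2 * 2 + r) (2 ^ (2 + t)) (markedFun t r)
markedFun-inOBDD t r = subst (λ d → InOBDD _ d (markedFun t r))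
  (trans (cong suc (length-map just (words (suc t)))) (length-words (suc t)))
  (machine-inOBDD (markedK (t * 2) r) (λ x → exec-run (t * 2) r x [] ≤-refl))
  where open StackMachine t

-- Five control bits for six marks

-- Paired marks never contain the pair (false , true), which serves as an escape:
-- 3 * 3 * 3 combinations of pairs fit into five bits.
code : (p q r s b : Bool) → Vec Bool 6
code false true r     s    b = r ∷ s ∷ false ∷ false ∷ false ∷ false ∷ []
code p     q    false true b = p ∷ q ∷ true ∷ b ∷ false ∷ false ∷ []
code p     q    r     s    b = p ∷ q ∷ r ∷ s ∷ true ∷ b ∷ []

code-escape : ∀ {p q} → PairMark p q → ∀ b → code p q false true b ≡ p ∷ q ∷ true ∷ b ∷ false ∷ false ∷ []
code-escape match b = refl
code-escape push² b = refl
code-escape pop²  b = refl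

code-direct : ∀ {p q r s} → PairMark p q → PairMark r s → ∀ b → code p q r s b ≡ p ∷ q ∷ r ∷ s ∷ true ∷ b ∷ []
code-direct match match b = refl
code-direct match push² b = refl
code-direct match pop²  b = refl
code-direct push² match b = refl
code-direct push² push² b = refl
code-direct push² pop²  b = refl
code-direct pop²  match b = refl
code-direct pop²  push² b = refl
code-direct pop²  pop²  b = refl

decode : List Bool → List Bool
decode (p ∷ q ∷ r ∷ s ∷ b ∷ c) = toList (code p q r s b) ++ decode c
decode _                       = []

-- The cases follow the trailing `pop²` pairs of a triple: none is coded directly, one by the escape
-- in the second pair, two or more by the escape in the first.
encode : ∀ B {M} → Paired (B * 3) M → ∃ λ c → decode c ≡ M × length c ≡ B * 5
encode zero    []                      = [] , refl , refl
encode (suc B) (_∷_ {p} {q} o (_∷_ {r} {s} o′ (match ∷ P))) with c , e , l ← encode B P =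
  p ∷ q ∷ r ∷ s ∷ false ∷ c , cong₂ (λ M M′ → toList M ++ M′) (code-direct o o′ false) e , cong (5 +_) l
encode (suc B) (_∷_ {p} {q} o (_∷_ {r} {s} o′ (push² ∷ P))) with c , e , l ← encode B P =
  p ∷ q ∷ r ∷ s ∷ true ∷ c , cong₂ (λ M M′ → toList M ++ M′) (code-direct o o′ true) e , cong (5 +_) l
encode (suc B) (_∷_ {p} {q} o (match ∷ pop² ∷ P)) with c , e , l ← encode B P =
  p ∷ q ∷ false ∷ true ∷ false ∷ c , cong₂ (λ M M′ → toList M ++ M′) (code-escape o false) e , cong (5 +_) l
encode (suc B) (_∷_ {p} {q} o (push² ∷ pop² ∷ P)) with c , e , l ← encode B P =
  p ∷ q ∷ false ∷ true ∷ true ∷ c , cong₂ (λ M M′ → toList M ++ M′) (code-escape o true) e , cong (5 +_) l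
encode (suc B) (_∷_ {p} {q} o (pop² ∷ pop² ∷ P)) with c , e , l ← encode B P =
  false ∷ true ∷ p ∷ q ∷ false ∷ c , cong (λ M → p ∷ q ∷ false ∷ false ∷ false ∷ false ∷ M) e , cong (5 +_) l

-- A block of 11 variables contributes a factor 2 ^ 3 to the width bound. This is 11/3 variables per
-- factor of two, below the 4 that `markedK` uses.
codedK : ∀ B r → Vec Kind (B * 11 + r)
codedK zero    r = skips r
codedK (suc B) r = Vec.replicate 5 ctl Vec.++ Vec.replicate 6 val Vec.++ codedK B r

length-ctls-codedK : ∀ B r (x : Fin (B * 11 + r) → A) → length (ctls (codedK B r) x) ≡ B * 5
length-ctls-codedK zero    r x = cong length (ctls-skips r x)
length-ctls-codedK (suc B) r x = cong (5 +_) (length-ctls-codedK B r _)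

length-vals-codedK : ∀ B r (x : Fin (B * 11 + r) → A) → length (vals (codedK B r) x) ≡ B * 3 * 2
length-vals-codedK zero    r x = cong length (vals-skips r x)
length-vals-codedK (suc B) r x = cong (6 +_) (length-vals-codedK B r _)

codedFun : ∀ B r → BoolFun (B * 11 + r)
codedFun B r = stackFun (codedK B r) decode

codedFun-fooling : ∀ B r → FoolingSets (B * 3) (codedFun B r)
codedFun-fooling B r = stackFun-fooling (codedK B r) decode (B * 3) (length-vals-codedK B r) λ M p →
  let c , e , l = encode B p in c , e , λ x → trans l (sym (length-ctls-codedK B r x))

-- Guessing a violated comparison

-- nothing: a violation has been found. just (h , nothing): no value is marked and
-- the stack has height h. just (h , just u): the value u was marked when it was
-- pushed, and h values lie above it.
Watch : Set
Watch = Maybe (ℕ × Maybe Bool)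

watch : Bool → Bool → Watch → List Watch
watch _     _ nothing                = nothing ∷ []
watch true  v (just (h , nothing))   = just (suc h , nothing) ∷ just (0 , just v) ∷ []
watch true  v (just (h , just u))    = just (suc h , just u) ∷ []
watch false v (just (suc h , k))     = just (h , k) ∷ []
watch false v (just (0 , nothing))   = nothing ∷ []
-- A marked value that turns out to match kills the run: the guess was wrong.
watch false v (just (0 , just u))    = if ⌊ u Boolₚ.≟ v ⌋ then [] else nothing ∷ []

-- A nonempty stack at the end is a violation, seen by the run without a mark. A marked value still
-- on the stack proves nothing about its comparison, so that run rejects.
violated : Watch → Bool
violated nothing                  = true
violated (just (suc h , nothing)) = true
violated _                        = false

watches : ℕ → List Watch
watches H = nothing ∷ map just (cartesianProduct (upTo (suc H)) (nothing ∷ just true ∷ just false ∷ []))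

∈-watches : ∀ H {h} k → h ≤ H → just (h , k) ∈ watches H
∈-watches H k h≤H = there (∈-map⁺ just (∈-cartesianProduct⁺ (∈-upTo⁺ (s≤s h≤H)) (k∈ k)))
  where
  k∈ : ∀ k → k ∈ nothing ∷ just true ∷ just false ∷ []
  k∈ nothing      = here refl
  k∈ (just true)  = there (here refl)
  k∈ (just false) = there (there (here refl))

length-watches : ∀ H → length (watches H) ≡ suc (suc H * 3)
length-watches H = cong suc (trans (length-map just (cartesianProduct (upTo (suc H)) marks))
  (trans (length-product (upTo (suc H))) (cong (_* 3) (length-upTo (suc H)))))
  where
  marks : List (Maybe Bool)
  marks = nothing ∷ just true ∷ just false ∷ []

  length-product : ∀ (hs : List ℕ) → length (cartesianProduct hs marks) ≡ length hs * 3
  length-product []       = refl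
  length-product (h ∷ hs) = cong (3 +_) (length-product hs)

-- Existence of a successful run on already decoded marks. It separates the correctness of guessing
-- from the buffering of control bits.
Detect : ℕ → List Bool → List Bool → Watch → Set
Detect H []      []      w = violated w ≡ true
Detect H (m ∷ M) (v ∷ V) w = ∃ λ w′ → w′ ∈ watch m v w × w′ ∈ watches H × Detect H M V w′
Detect H _       _       w = ⊥

data At : List Bool → ℕ → Bool → Set where
  here  : ∀ {u st} → At (u ∷ st) 0 u
  there : ∀ {u v st h} → At st h u → At (v ∷ st) (suc h) u

-- The marked value stays on the stack until it is popped, so success means that it is then compared
-- with a different value, unless the stack run fails even earlier.
detect-marked : ∀ {H} M V {st h u} → At st h u → Detect H M V (just (h , just u)) → run st M V ≡ false
detect-marked []         []      here       ()
detect-marked []         []      (there _)  ()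
detect-marked (true ∷ M) (v ∷ V) at (_ , here refl , _ , d) = detect-marked M V (there at) d
detect-marked (false ∷ M) (v ∷ V) (here {u}) d with u Boolₚ.≟ v
... | no _ = refl
detect-marked (false ∷ M) (v ∷ V) (there {v = u} at) (_ , here refl , _ , d) with u Boolₚ.≟ v
... | yes _ = detect-marked M V at d
... | no _  = refl

detect-sound : ∀ {H} M V st → Detect H M V (just (length st , nothing)) → run st M V ≡ false
detect-sound []          []      (_ ∷ _)  d = refl
detect-sound (true ∷ M)  (v ∷ V) st       (_ , here refl , _ , d)         = detect-sound M V (v ∷ st) d
detect-sound (true ∷ M)  (v ∷ V) st       (_ , there (here refl) , _ , d) = detect-marked M V here d
detect-sound (false ∷ M) (v ∷ V) []       d = refl
detect-sound (false ∷ M) (v ∷ V) (u ∷ st) (_ , here refl , _ , d) with u Boolₚ.≟ v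
... | yes _ = detect-sound M V st d
... | no _  = refl

detect-nothing : ∀ {H} M V → length M ≡ length V → Detect H M V nothing
detect-nothing []      []      _ = refl
detect-nothing (_ ∷ M) (_ ∷ V) l = nothing , here refl , here refl , detect-nothing M V (suc-injective l)

at-< : ∀ {st h u} → At st h u → h < length st
at-< here       = s≤s z≤n
at-< (there at) = s≤s (at-< at)

-- Generalised to a nonempty stack, where the mark may have to be set in the past: the second
-- alternative names a value on the stack that should have been marked. The bound `H` keeps all
-- heights within `watches H`.
detect-complete : ∀ {H} M V st → length M ≡ length V → length st + length M ≤ H → run st M V ≡ false →
  Detect H M V (just (length st , nothing)) ⊎ (∃₂ λ h u → At st h u × Detect H M V (just (h , just u)))
detect-complete []         []      (_ ∷ _) _ _ _ = inj₁ refl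
detect-complete {H} (true ∷ M) (v ∷ V) st l b r
  with b′ ← subst (_≤ H) (+-suc (length st) (length M)) b
  with detect-complete M V (v ∷ st) (suc-injective l) b′ r
... | inj₁ d                      = inj₁ (_ , here refl , ∈-watches H nothing (m+n≤o⇒m≤o _ b′) , d)
-- The offending value is the one being pushed, so the guess is made now.
... | inj₂ (_ , _ , here , d)     = inj₁ (_ , there (here refl) , ∈-watches H (just v) z≤n , d)
... | inj₂ (_ , u , there at , d) =
  inj₂ (_ , u , at , _ , here refl , ∈-watches H (just u) (≤-trans (at-< at) (m+n≤o⇒m≤o _ b)) , d)
detect-complete (false ∷ M) (v ∷ V) [] l b r =
  inj₁ (_ , here refl , here refl , detect-nothing M V (suc-injective l))
detect-complete {H} (false ∷ M) (v ∷ V) (u ∷ st) l b r with u Boolₚ.≟ v in eq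
... | no _ = inj₂ (0 , u , here , nothing , found , here refl , detect-nothing M V (suc-injective l))
  where
  found : nothing ∈ watch false v (just (0 , just u))
  found rewrite eq = here refl
... | yes _
  with b′ ← ≤-trans (+-mono-≤ (n≤1+n (length st)) (n≤1+n (length M))) b
  with detect-complete M V st (suc-injective l) b′ r
... | inj₁ d                 = inj₁ (_ , here refl , ∈-watches H nothing (m+n≤o⇒m≤o _ b′) , d)
... | inj₂ (h , u′ , at , d) =
  inj₂ (suc h , u′ , there at , _ , here refl , ∈-watches H (just u′) (≤-trans (<⇒≤ (at-< at)) (m+n≤o⇒m≤o _ b′)) , d)

-- The buffer collects the control bits of a block and then holds its remaining marks.
module WatchMachine (H : ℕ) where

  State : Set
  State = List Bool × Watch

  _≟ₛ_ : DecidableEquality State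
  _≟ₛ_ = Productₚ.≡-dec (Listₚ.≡-dec Boolₚ._≟_)
          (Maybeₚ.≡-dec (Productₚ.≡-dec _≟_ (Maybeₚ.≡-dec Boolₚ._≟_)))

  load : List Bool → Bool → List Bool
  load (p ∷ q ∷ r ∷ s ∷ []) b = toList (code p q r s b)
  load buf                  b = buf ∷ʳ b

  succs : Kind → State → Bool → List State
  succs skip a             _ = a ∷ []
  succs ctl  (buf , w)     b = (load buf b , w) ∷ []
  succs val  ([] , w)      v = []
  succs val  (m ∷ buf , w) v = map (buf ,_) (watch m v w)

  -- A buffer holds at most six marks, which gives 2 ^ 7 - 1 = 127 buffers.
  states : List State
  states = cartesianProduct (words 6) (watches H)

  open NondetMachine _≟ₛ_ succs ([] , just (0 , nothing)) (violated ∘ proj₂) states public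

  accept-skips⁺ : ∀ r x {a} → a ∈ states → violated (proj₂ a) ≡ true → Acc (skips r) x a
  accept-skips⁺ zero    x m e = e
  accept-skips⁺ (suc r) x m e = _ , here refl , m , accept-skips⁺ r _ m e

  accept-skips⁻ : ∀ r x {a} → Acc (skips r) x a → violated (proj₂ a) ≡ true
  accept-skips⁻ zero    x e = e
  accept-skips⁻ (suc r) x (_ , here refl , _ , r′) = accept-skips⁻ r _ r′

  -- The value steps of a block use up the buffer mark by mark; `rest` treats the following blocks,
  -- which start with an empty buffer.
  vals⇒detect : ∀ {m} (Ms : Vec Bool m) (K : Vec Kind n) (x : Fin (m + n) → Bool) M {w} →
    (∀ w → Acc K (x ∘ (m ↑ʳ_)) ([] , w) → Detect H M (vals K (x ∘ (m ↑ʳ_))) w) →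
    Acc (Vec.replicate m val Vec.++ K) x (toList Ms , w) →
    Detect H (toList Ms ++ M) (vals (Vec.replicate m val Vec.++ K) x) w
  vals⇒detect []       K x M rest a = rest _ a
  vals⇒detect (m ∷ Ms) K x M rest (_ , s , m∈ , a) with w′ , w′∈ , refl ← ∈-map⁻ _ s =
    w′ , w′∈ , proj₂ (∈-cartesianProduct⁻ (words 6) (watches H) m∈) , vals⇒detect Ms K (x ∘ Fin.suc) M rest a

  detect⇒vals : ∀ {m} (Ms : Vec Bool m) (K : Vec Kind n) (x : Fin (m + n) → Bool) M {w} → m ≤ 6 →
    w ∈ watches H →
    (∀ w → w ∈ watches H → Detect H M (vals K (x ∘ (m ↑ʳ_))) w → Acc K (x ∘ (m ↑ʳ_)) ([] , w)) →
    Detect H (toList Ms ++ M) (vals (Vec.replicate m val Vec.++ K) x) w →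
    Acc (Vec.replicate m val Vec.++ K) x (toList Ms , w)
  detect⇒vals []       K x M m≤6 w∈ rest d = rest _ w∈ d
  detect⇒vals (m ∷ Ms) K x M m<6 w∈ rest (w′ , s , w′∈ , d) =
    _ , ∈-map⁺ _ s , ∈-cartesianProduct⁺ (∈-words⁺ 6 (subst (_≤ 6) (sym (length-toList Ms)) (<⇒≤ m<6))) w′∈ ,
    detect⇒vals Ms K (x ∘ Fin.suc) M (<⇒≤ m<6) w′∈ rest d

  acc⇒detect : ∀ B r x w → Acc (codedK B r) x ([] , w) →
               Detect H (decode (ctls (codedK B r) x)) (vals (codedK B r) x) w
  acc⇒detect zero r x w a rewrite ctls-skips r x | vals-skips r x = accept-skips⁻ r x a
  acc⇒detect (suc B) r x w
    (_ , here refl , _ , _ , here refl , _ , _ , here refl , _ , _ , here refl , _ , _ , here refl , _ , a) =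
    vals⇒detect (code _ _ _ _ _) (codedK B r) (x ∘ (5 ↑ʳ_)) _ (acc⇒detect B r _) a

  detect⇒acc : ∀ B r x w → w ∈ watches H → Detect H (decode (ctls (codedK B r) x)) (vals (codedK B r) x) w →
               Acc (codedK B r) x ([] , w)
  detect⇒acc zero r x w w∈ d rewrite ctls-skips r x | vals-skips r x =
    accept-skips⁺ r x (∈-cartesianProduct⁺ (∈-words⁺ 6 z≤n) w∈) d
  detect⇒acc (suc B) r x w w∈ d =
    -- The buffer has length 1 to 4 while bits are collected; the fifth bit turns it into six marks.
    _ , here refl , buf∈ (≤ᵇ⇒≤ 1 6 _) ,
    _ , here refl , buf∈ (≤ᵇ⇒≤ 2 6 _) ,
    _ , here refl , buf∈ (≤ᵇ⇒≤ 3 6 _) ,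
    _ , here refl , buf∈ (≤ᵇ⇒≤ 4 6 _) ,
    _ , here refl , buf∈ (≤-reflexive (length-toList marks)) ,
    detect⇒vals (code _ _ _ _ _) (codedK B r) (x ∘ (5 ↑ʳ_)) _ ≤-refl w∈ (detect⇒acc B r _) d
    where
    marks = code (x (# 0)) (x (# 1)) (x (# 2)) (x (# 3)) (x (# 4))
    buf∈ : ∀ {buf} → length buf ≤ 6 → (buf , w) ∈ states
    buf∈ p = ∈-cartesianProduct⁺ (∈-words⁺ 6 p) w∈

length-decode : ∀ B c → length c ≡ B * 5 → length (decode c) ≡ B * 3 * 2
length-decode zero    []                      _ = refl
length-decode (suc B) (p ∷ q ∷ r ∷ s ∷ b ∷ c) l = trans (length-++ (toList (code p q r s b)))
  (cong₂ _+_ (length-toList (code p q r s b)) (length-decode B c (+-cancelˡ-≡ 5 _ _ l)))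

¬codedFun-inNOBDD : ∀ B r → InNOBDD (B * 11 + r) (127 * suc (suc (B * 3 * 2) * 3)) (not ∘ codedFun B r)
¬codedFun-inNOBDD B r = subst (λ d → InNOBDD _ d (not ∘ codedFun B r))
  (trans (length-product (words 6)) (cong (127 *_) (length-watches H)))
  (machine-inNOBDD (codedK B r) (s≤s z≤n) λ x → mk⇔ (to x) (from x))
  where
  -- The number of marks bounds the stack height.
  H = B * 3 * 2
  open WatchMachine H

  length-product : ∀ (ls : List (List Bool)) → length (cartesianProduct ls (watches H)) ≡ length ls * length (watches H)
  length-product []       = refl
  length-product (l ∷ ls) = trans (length-++ (map (l ,_) (watches H)))
    (cong₂ _+_ (length-map (l ,_) (watches H)) (length-product ls))

  to : ∀ x → not (codedFun B r x) ≡ true → Acc (codedK B r) x ([] , just (0 , nothing))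
  to x e with detect-complete (decode (ctls (codedK B r) x)) (vals (codedK B r) x) []
                (trans lenM (sym (length-vals-codedK B r x))) (≤-reflexive lenM) (Boolₚ.not-injective e)
    where
    lenM : length (decode (ctls (codedK B r) x)) ≡ H
    lenM = length-decode B (ctls (codedK B r) x) (length-ctls-codedK B r x)
  ... | inj₁ d = detect⇒acc B r x _ (∈-watches H nothing z≤n) d
  -- The initial stack is empty and offers no value to mark.
  ... | inj₂ (_ , _ , () , _)

  from : ∀ x → Acc (codedK B r) x ([] , just (0 , nothing)) → not (codedFun B r x) ≡ true
  from x a = cong not (detect-sound {H} (decode (ctls (codedK B r) x)) (vals (codedK B r) x) []
    (acc⇒detect B r x _ a))

-- Parameters

2^e≤n⇒e≤⌊log₂n⌋ : ∀ e n → 2 ^ e ≤ n → e ≤ ⌊log₂ n ⌋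
2^e≤n⇒e≤⌊log₂n⌋ e n p = subst (_≤ ⌊log₂ n ⌋) (⌊log₂[2^n]⌋≡n e) (⌊log₂⌋-mono-≤ p)

n<2^[1+⌊log₂n⌋] : ∀ n → n < 2 ^ suc ⌊log₂ n ⌋
n<2^[1+⌊log₂n⌋] n = ≰⇒> (λ p → <-irrefl refl (2^e≤n⇒e≤⌊log₂n⌋ (suc ⌊log₂ n ⌋) n p))

-- Halving lowers the logarithm by one, so the bound for `⌊ n /2⌋` doubles to the bound for `n`.
2^⌊log₂n⌋≤n : ∀ n → 1 ≤ n → 2 ^ ⌊log₂ n ⌋ ≤ n
2^⌊log₂n⌋≤n = <-rec (λ n → 1 ≤ n → 2 ^ ⌊log₂ n ⌋ ≤ n) go
  where
  go : ∀ n → (∀ {k} → k < n → 1 ≤ k → 2 ^ ⌊log₂ k ⌋ ≤ k) → 1 ≤ n → 2 ^ ⌊log₂ n ⌋ ≤ n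
  go 1               _   _ = ≤-refl
  go n@(suc (suc k)) rec _ = begin
    2 ^ ⌊log₂ n ⌋                 ≡⟨ cong (2 ^_) (m+[n∸m]≡n (2^e≤n⇒e≤⌊log₂n⌋ 1 n (s≤s (s≤s z≤n)))) ⟨
    2 * 2 ^ (⌊log₂ n ⌋ ∸ 1)       ≡⟨ cong (λ e → 2 * 2 ^ e) (⌊log₂⌊n/2⌋⌋≡⌊log₂n⌋∸1 n) ⟨
    2 * 2 ^ ⌊log₂ ⌊ n /2⌋ ⌋       ≤⟨ *-monoʳ-≤ 2 (rec (⌊n/2⌋<n (suc k)) (s≤s z≤n)) ⟩
    ⌊ n /2⌋ + (⌊ n /2⌋ + 0)       ≡⟨ cong (⌊ n /2⌋ +_) (+-identityʳ _) ⟩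
    ⌊ n /2⌋ + ⌊ n /2⌋             ≤⟨ +-monoʳ-≤ ⌊ n /2⌋ (⌊n/2⌋≤⌈n/2⌉ n) ⟩
    ⌊ n /2⌋ + _                   ≡⟨ ⌊n/2⌋+⌈n/2⌉≡n n ⟩
    n                             ∎
    where open ≤-Reasoning

-- The two hard functions and the separation

hard-for-NOBDD : ∀ n t → t * 2 * 2 ≤ n →
  ∃ λ f → InOBDD n (2 ^ (2 + t)) f × (∀ w → InNOBDD n w f → 2 ^ t ≤ w)
hard-for-NOBDD n t p with r , refl ← m≤n⇒∃[o]m+o≡n p =
  markedFun t r , markedFun-inOBDD t r , λ w → nobdd-lower-bound {T = t} (markedFun-fooling t r)

hard-for-OBDD : ∀ n B → B * 11 ≤ n →
  ∃ λ f → InNOBDD n (127 * suc (suc (B * 3 * 2) * 3)) f × (∀ w → InOBDD n w f → 2 ^ (B * 3) ≤ w)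
hard-for-OBDD n B p with r , refl ← m≤n⇒∃[o]m+o≡n p =
  not ∘ codedFun B r , ¬codedFun-inNOBDD B r , λ w → obdd-lower-bound {T = B * 3} (codedFun-fooling B r)

-- The function `f` serves twice: its NOBDD width exceeds `d′` and therefore `m`, which gives
-- strictness in (i) and one half of (ii). The function `f′` gives the other half.
separation : ∀ {n d d′ m t W T} → 2 ^ m ≤ d → 2 ^ (2 + t) ≤ d → m ≤ d′ → d′ < 2 ^ t → W ≤ d′ → d < 2 ^ T →
  (∃ λ f → InOBDD n (2 ^ (2 + t)) f × (∀ w → InNOBDD n w f → 2 ^ t ≤ w)) →
  (∃ λ f → InNOBDD n W f × (∀ w → InOBDD n w f → 2 ^ T ≤ w)) →
  (InNOBDD n m ⊊ᶜ InOBDD n d) × Incomparable (InOBDD n d) (InNOBDD n d′)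
separation 2^m≤d 2^[2+t]≤d m≤d′ d′<2^t W≤d′ d<2^T (f , f∈ , f-hard) (f′ , f′∈ , f′-hard) =
    ( (λ _ → powerset-inOBDD 2^m≤d)
    , f , inOBDD-mono 2^[2+t]≤d f∈ , λ f∈m → <⇒≱ (≤-<-trans m≤d′ d′<2^t) (f-hard _ f∈m) )
  , (λ sub → <⇒≱ d′<2^t (f-hard _ (sub f (inOBDD-mono 2^[2+t]≤d f∈))))
  , (λ sub → <⇒≱ d<2^T (f′-hard _ (sub f′ (inNOBDD-mono W≤d′ f′∈))))

linear-bound : ∀ K → ∃ λ C → ∃ λ N → ∀ d → N ≤ d →
  K * suc ⌊log₂ d ⌋ ≤ C * (⌊log₂ (d + 1) ⌋ ^ 4) * ⌊log₂ ⌊log₂ (d + 1) ⌋ ⌋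
-- From d = 3 on log (d + 1) is at least 2, so the iterated logarithm is positive; one factor 2
-- absorbs the successor.
linear-bound K = K * 2 , 3 , bound
  where
  open ≤-Reasoning
  bound : ∀ d → 3 ≤ d → K * suc ⌊log₂ d ⌋ ≤ K * 2 * (⌊log₂ (d + 1) ⌋ ^ 4) * ⌊log₂ ⌊log₂ (d + 1) ⌋ ⌋
  bound d 3≤d = begin
    K * suc ⌊log₂ d ⌋       ≤⟨ *-monoʳ-≤ K (s≤s (⌊log₂⌋-mono-≤ (m≤m+n d 1))) ⟩
    K * suc L               ≤⟨ *-monoʳ-≤ K (+-monoˡ-≤ L 1≤L) ⟩
    K * (L + L)             ≡⟨ solve 2 (λ K L → K :* (L :+ L) := K :* con 2 :* (L :* con 1)) refl K L ⟩
    K * 2 * L ^ 1           ≤⟨ *-monoʳ-≤ (K * 2) (^-monoʳ-≤ L {1} {4} (s≤s z≤n)) ⟩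
    K * 2 * L ^ 4           ≤⟨ m≤m*n (K * 2 * L ^ 4) ⌊log₂ L ⌋ ⟩
    K * 2 * L ^ 4 * ⌊log₂ L ⌋ ∎
    where
    open +-*-Solver
    L = ⌊log₂ (d + 1) ⌋
    2≤L : 2 ≤ L
    2≤L = 2^e≤n⇒e≤⌊log₂n⌋ 2 (d + 1) (+-monoˡ-≤ 1 3≤d)
    1≤L : 1 ≤ L
    1≤L = <⇒≤ 2≤L
    instance
      _ = >-nonZero 1≤L
      _ = >-nonZero (2^e≤n⇒e≤⌊log₂n⌋ 1 L 2≤L)

-- e ≥ 30 forces log d ≥ 33, the threshold for 11 (⌊log d / 3⌋ + 1) ≤ 4 log d.
module Parameters (e : ℕ) (30≤e : 30 ≤ e) (n d d′ : ℕ) (d⁴≤2ⁿ : d ^ 4 ≤ 2 ^ n)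
                  (gd<d′ : 2 ^ e * suc ⌊log₂ d ⌋ < d′) (8d′<d : 8 * (d′ + 1) < d) where

  open ≤-Reasoning

  K m t B : ℕ
  K = 2 ^ e
  m = ⌊log₂ d ⌋
  -- Then 2 ^ (2 + t) is 2 ^ m, at most d, while 2 ^ t still exceeds d / 8.
  t = m ∸ 2
  -- The least number of blocks with 3 B > m, so that 2 ^ (3 B) exceeds d.
  B = suc (m / 3)

  -- 2794 = 127 * 22 is the multiplier of m + 1 in the bound on the watching width.
  2794≤K : 2794 ≤ K
  2794≤K = ≤-trans (≤ᵇ⇒≤ 2794 (2 ^ 12) _) (^-monoʳ-≤ 2 (≤-trans (≤ᵇ⇒≤ 12 30 _) 30≤e))

  33≤m : 33 ≤ m
  33≤m = ≤-trans (+-monoʳ-≤ 3 30≤e) (2^e≤n⇒e≤⌊log₂n⌋ (3 + e) d (begin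
    2 ^ (3 + e)  ≡⟨ ^-distribˡ-+-* 2 3 e ⟩
    8 * K        ≤⟨ *-monoʳ-≤ 8 (≤-trans (m≤m*n K (suc m)) (<⇒≤ gd<d′)) ⟩
    8 * d′       ≤⟨ *-monoʳ-≤ 8 (m≤m+n d′ 1) ⟩
    8 * (d′ + 1) <⟨ 8d′<d ⟩
    d            ∎))

  2+t≡m : 2 + t ≡ m
  2+t≡m = m+[n∸m]≡n (≤-trans (s≤s (s≤s z≤n)) 33≤m)

  2^m≤d : 2 ^ m ≤ d
  2^m≤d = 2^⌊log₂n⌋≤n d (≤-trans (s≤s z≤n) 8d′<d)

  m≤d′ : m ≤ d′
  m≤d′ = begin
    m         ≤⟨ n≤1+n m ⟩
    suc m     ≤⟨ m≤n*m (suc m) K ⟩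
    K * suc m ≤⟨ <⇒≤ gd<d′ ⟩
    d′        ∎
    where
    instance
      _ = >-nonZero (≤-trans (s≤s z≤n) 2794≤K)

  m*4≤n : m * 4 ≤ n
  m*4≤n = subst (m * 4 ≤_) (⌊log₂[2^n]⌋≡n n) (2^e≤n⇒e≤⌊log₂n⌋ (m * 4) (2 ^ n) (begin
    2 ^ (m * 4) ≡⟨ ^-*-assoc 2 m 4 ⟨
    (2 ^ m) ^ 4 ≤⟨ ^-monoˡ-≤ 4 2^m≤d ⟩
    d ^ 4       ≤⟨ d⁴≤2ⁿ ⟩
    2 ^ n       ∎))

  t*2*2≤n : t * 2 * 2 ≤ n
  t*2*2≤n = begin
    t * 2 * 2 ≡⟨ *-assoc t 2 2 ⟩
    t * 4     ≤⟨ *-monoˡ-≤ 4 (m∸n≤m m 2) ⟩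
    m * 4     ≤⟨ m*4≤n ⟩
    n         ∎

  d′<2^t : d′ < 2 ^ t
  d′<2^t = *-cancelˡ-< 8 d′ (2 ^ t) (begin-strict
    8 * d′        ≤⟨ *-monoʳ-≤ 8 (m≤m+n d′ 1) ⟩
    8 * (d′ + 1)  <⟨ 8d′<d ⟩
    d             <⟨ n<2^[1+⌊log₂n⌋] d ⟩
    2 ^ suc m     ≡⟨ cong (λ e → 2 ^ suc e) 2+t≡m ⟨
    2 ^ (3 + t)   ≡⟨ ^-distribˡ-+-* 2 3 t ⟩
    8 * 2 ^ t     ∎)

  B*3≤3+m : B * 3 ≤ 3 + m
  B*3≤3+m = +-monoʳ-≤ 3 (m/n*n≤m m 3)

  m<B*3 : m < B * 3
  m<B*3 = begin-strict
    m                   ≡⟨ m≡m%n+[m/n]*n m 3 ⟩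
    m % 3 + m / 3 * 3   <⟨ +-monoˡ-< (m / 3 * 3) (m%n<n m 3) ⟩
    B * 3               ∎

  B*11≤n : B * 11 ≤ n
  B*11≤n = ≤-trans (*-cancelˡ-≤ 3 (begin
    3 * (B * 11)  ≡⟨ solve 1 (λ B → con 3 :* (B :* con 11) := B :* con 3 :* con 11) refl B ⟩
    B * 3 * 11    ≤⟨ *-monoˡ-≤ 11 B*3≤3+m ⟩
    (3 + m) * 11  ≡⟨ *-distribʳ-+ 11 3 m ⟩
    -- The loss of 33 from rounding up to whole blocks is paid by the spare twelfth m.
    33 + m * 11   ≤⟨ +-monoˡ-≤ (m * 11) 33≤m ⟩
    m + m * 11    ≡⟨ solve 1 (λ m → m :+ m :* con 11 := con 3 :* (m :* con 4)) refl m ⟩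
    3 * (m * 4)   ∎)) m*4≤n
    where open +-*-Solver

  d<2^[B*3] : d < 2 ^ (B * 3)
  d<2^[B*3] = <-≤-trans (n<2^[1+⌊log₂n⌋] d) (^-monoʳ-≤ 2 m<B*3)

  watchWidth≤d′ : 127 * suc (suc (B * 3 * 2) * 3) ≤ d′
  watchWidth≤d′ = begin
    127 * suc (suc (B * 3 * 2) * 3)   ≤⟨ *-monoʳ-≤ 127 (s≤s (*-monoˡ-≤ 3 (s≤s (*-monoˡ-≤ 2 B*3≤3+m)))) ⟩
    127 * suc (suc ((3 + m) * 2) * 3) ≤⟨ *-monoʳ-≤ 127 (m≤m+n (suc (suc ((3 + m) * 2) * 3)) (16 * m)) ⟩
    127 * (suc (suc ((3 + m) * 2) * 3) + 16 * m)
      ≡⟨ cong (127 *_) (solve 1 (λ m → con 1 :+ (con 1 :+ (con 3 :+ m) :* con 2) :* con 3 :+ con 16 :* m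
                                     := con 22 :* (con 1 :+ m)) refl m) ⟩
    127 * (22 * suc m)                ≡⟨ *-assoc 127 22 (suc m) ⟨
    127 * 22 * suc m                  ≤⟨ *-monoˡ-≤ (suc m) {2794} {K} 2794≤K ⟩
    K * suc m                         <⟨ gd<d′ ⟩
    d′                                ∎
    where open +-*-Solver

  hierarchy : (InNOBDD n ⌊log₂ d ⌋ ⊊ᶜ InOBDD n d) × Incomparable (InOBDD n d) (InNOBDD n d′)
  hierarchy = separation {t = t} {127 * suc (suc (B * 3 * 2) * 3)} {B * 3}
    2^m≤d (subst (λ e → 2 ^ e ≤ d) (sym 2+t≡m) 2^m≤d) m≤d′ d′<2^t watchWidth≤d′ d<2^[B*3]
    (hard-for-NOBDD n t t*2*2≤n) (hard-for-OBDD n B B*11≤n)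

-- The exponent stays a variable, so that 2 ^ e is handled symbolically throughout.
theorem10-at : ∀ e → 30 ≤ e → Σ (ℕ → ℕ) λ g →
    (∃ λ C → ∃ λ N → ∀ d → N ≤ d →
    g d ≤ C * (⌊log₂ (d + 1) ⌋ ^ 4) * ⌊log₂ ⌊log₂ (d + 1) ⌋ ⌋)
    × (∀ n d d′ → d ^ 4 ≤ 2 ^ n → g d < d′ → 8 * (d′ + 1) < d →
    (InNOBDD n ⌊log₂ d ⌋ ⊊ᶜ InOBDD n d)
    × Incomparable (InOBDD n d) (InNOBDD n d′))
theorem10-at e 30≤e = (λ d → 2 ^ e * suc ⌊log₂ d ⌋) , linear-bound (2 ^ e) , Parameters.hierarchy e 30≤e

theorem10 : Σ (ℕ → ℕ) λ g →
    (∃ λ C → ∃ λ N → ∀ d → N ≤ d →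
    g d ≤ C * (⌊log₂ (d + 1) ⌋ ^ 4) * ⌊log₂ ⌊log₂ (d + 1) ⌋ ⌋)
    × (∀ n d d′ → d ^ 4 ≤ 2 ^ n → g d < d′ → 8 * (d′ + 1) < d →
    (InNOBDD n ⌊log₂ d ⌋ ⊊ᶜ InOBDD n d)
    × Incomparable (InOBDD n d) (InNOBDD n d′))
theorem10 = theorem10-at 30 ≤-refl
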